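{- Let $A\in\mathbb{Z}^{r\times n}$, $\mathbf{b}\in\mathbb{Z}^r$, $M=\begin{pmatrix}\mathrm{id}_n&\mathbf{0}\\ A&-\mathbf{b}\end{pmatrix}$, and let $M_k\langle I;J\rangle$ be a (well-defined) matrix obtained from $M$ by $k$ successive pivot operations with row index set $I\subseteq[r]$ and column index set $J\subseteq[n]$, $|I|=|J|=k$. Let $i\in[r]\setminus I$, $j\in[n]\setminus J$, and suppose the pivot item $p_{k+1}$, i.e. the $(n+i,j)$ entry of $M_k\langle I;J\rangle$, is nonzero. Then $$\mathop{\mathrm{CT}}_{\lambda_i,j}[M_k\langle I;J\rangle]=\mathrm{sgn}(p_{k+1})\,\mathcal{Z}_{y_j}\big[M_k\langle I;J\rangle\leftarrow(i,j)\big].$$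
   Context: Variables: $\mathbf{y}=(y_1,\dots,y_n)$, $\Lambda=(\lambda_1,\dots,\lambda_r)$. "Fractional" means that rational exponents are allowed. $[n]=\{1,\dots,n\}$. Matrix forms. For an $(n+r)\times(n+1)$ matrix $O$ with nonzero $(n+i,j)$ entry ($i\in[r]$, $j\in[n]$), $O\leftarrow(i,j)$ is obtained from $O$ by adding $-O_{n+i,s}/O_{n+i,j}$ times column $j$ to column $s$ for all $s\neq j$; row $n+i$ and column $j$ are ignored afterwards. For $I=\{i_1,\dots,i_k\}$, $J=\{j_1,\dots,j_k\}$, $M_k\langle I;J\rangle=M\leftarrow(i_1,j_1)\leftarrow\cdots\leftarrow(i_k,j_k)$ (assuming all pivots are nonzero), with rows $n+I$ and columns $J$ ignored. With columns $\gamma_1,\dots,\gamma_{n+1}$ of $M_k\langle I;J\rangle$ set $[M_k\langle I;J\rangle]=(\mathbf{y},\Lambda)^{\gamma_{n+1}}\big/\prod_{j\in[n]\setminus J}\big(1-(\mathbf{y},\Lambda)^{\gamma_j}\big)$, entries in ignored rows being omitted. In $[M_k\langle I;J\rangle\leftarrow(i,j)]$ the ignored rows are $n+(I\cup\{i\})$ and the ignored columns $J\cup\{j\}$. $\mathcal{Z}_{y_j}$ acts on fractional series by keeping exactly the terms in which the exponent of $y_j$ is an integer; applied to a fractional rational function with denominator a product of factors $1-(\text{monomial})$ the result is a rational function independent of the chosen series expansion. The operator $\mathrm{CT}_{\lambda,j}$. Let $E=L(\lambda)/\prod_{\ell}(1-u_\ell\lambda^{b_\ell})$ be a fractional rational function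 with pairwise coprime denominator factors, $u_\ell$ free of $\lambda$, $b_\ell\in\mathbb{Q}$. If $b_j\neq0$ and the variable $y_j$ appears only in $u_j=y_ju_j'$ (with $u_j'$ free of $y_j$), then $$\mathrm{CT}_{\lambda,j}E:=\mathrm{sgn}(b_j)\,\mathcal{Z}_{y_j}\Big(\big(E\cdot(1-u_j\lambda^{b_j})\big)\big|_{\lambda=(y_ju_j')^{ -1/b_j}}\Big).$$ -}

module Defs where

open import Data.Bool using (true; false; if_then_else_)
open import Data.Empty using (⊥-elim)
open import Data.Fin using (Fin; zero; suc; _↑ˡ_; _↑ʳ_)
import Data.Fin as Fin
open import Data.Fin.Subset using (Subset; _∈_; _∉_; _∪_; _-_; ⁅_⁆; ∁; ⊥)
open import Data.Fin.Subset.Properties using (_∈?_)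
open import Data.Integer using (ℤ; +_; +0; +[1+_]; -[1+_])
import Data.Integer as ℤ
import Data.Integer.Properties as ℤ
open import Data.List using (List; []; _∷_; filter; foldr; allFin; cartesianProductWith; upTo)
import Data.List as List
open import Data.List.Membership.Propositional using () renaming (_∈_ to _∈ˡ_)
open import Data.List.Membership.Propositional.Properties
  using (∈-map⁺; ∈-map⁻; ∈-filter⁺; ∈-filter⁻; ∈-allFin; ∈-upTo⁺; ∈-cartesianProductWith⁺)
open import Data.List.Relation.Unary.All using (All; []; _∷_)
import Data.List.Relation.Unary.All as All
open import Data.List.Relation.Unary.Any using (here; there)
open import Data.Nat using (ℕ; zero; suc)
import Data.Nat as ℕ
import Data.Nat.Coprimality as Coprimality
import Data.Nat.Properties as ℕ
open import Data.Product using (∃-syntax; _×_; _,_; proj₁; proj₂; map₁; map₂)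
open import Data.Rational using (ℚ; mkℚ; 0ℚ; 1ℚ; _/_; 1/_; _÷_; NonZero; ↥_; ↧_; ↧ₙ_; _≤_; _<_; toℚᵘ; fromℚᵘ)
  renaming (_+_ to _+ℚ_; _*_ to _*ℚ_; _-_ to _-ℚ_; -_ to -ℚ_)
import Data.Rational as ℚ
import Data.Rational.Properties as ℚ
open import Data.Rational.Solver using (module +-*-Solver)
open +-*-Solver using (solve; _:+_; _:*_; :-_; _:=_; con)
open import Data.Rational.Unnormalised using (mkℚᵘ; *≡*)
import Data.Rational.Unnormalised as ℚᵘ
import Data.Rational.Unnormalised.Properties as ℚᵘ
open import Data.Sum using (_⊎_; inj₁; inj₂)
open import Data.Vec using (Vec; []; _∷_; lookup; _[_]≔_)
import Data.Vec as Vec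
import Data.Vec.Functional as Functional
open import Data.Vec.Functional using (Vector)
import Data.Vec.Properties as Vec
open import Function using (_∘_; _$_)
open import Relation.Binary using (tri<; tri≈; tri>)
open import Relation.Binary.PropositionalEquality
open import Relation.Nullary using (¬_; Dec; yes; no; does; contradiction)
open import Relation.Nullary.Decidable using (dec-true; dec-false)

private variable
  N d : ℕ

-- An exponent vector e stands for the monomial x^e = x₁^e₁ ⋯ x_N^e_N.
Exponent : ℕ → Set
Exponent N = Vec ℚ N

infixl 6 _⊕_ _⊖_
infixr 7 _⊛_

𝟘 : Exponent N
𝟘 = Vec.replicate _ 0ℚ

_⊕_ _⊖_ : Exponent N → Exponent N → Exponent N
_⊕_ = Vec.zipWith _+ℚ_
_⊖_ = Vec.zipWith _-ℚ_

_⊛_ : ℚ → Exponent N → Exponent N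
q ⊛ e = Vec.map (q *ℚ_) e

_≟ᵉ_ : (e f : Exponent N) → Dec (e ≡ f)
_≟ᵉ_ = Vec.≡-dec ℚ._≟_

-- A finite sum of terms c x^e with rational exponents; terms need be neither
-- distinct nor nonzero, so equality is equality of all coefficients.
Laurent : ℕ → Set
Laurent N = List (ℚ × Exponent N)

coeff : Laurent N → Exponent N → ℚ
coeff []            e = 0ℚ
coeff ((c , m) ∷ f) e = (if does (e ≟ᵉ m) then c else 0ℚ) +ℚ coeff f e

infix 4 _≐_
_≐_ : Laurent N → Laurent N → Set
f ≐ g = ∀ e → coeff f e ≡ coeff g e

infixl 6 _+ᴸ_
infixl 7 _*ᴸ_

_+ᴸ_ _*ᴸ_ : Laurent N → Laurent N → Laurent N
_+ᴸ_ = List._++_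
_*ᴸ_ = cartesianProductWith λ (c , m) (c′ , m′) → c *ℚ c′ , m ⊕ m′

1ᴸ : Laurent N
1ᴸ = (1ℚ , 𝟘) ∷ []

binomial : Exponent N → Laurent N
binomial m = (1ℚ , 𝟘) ∷ (-ℚ 1ℚ , m) ∷ []

FreeOf : Fin N → Laurent N → Set
FreeOf x f = ∀ e → coeff f e ≢ 0ℚ → lookup e x ≡ 0ℚ

-- The fraction num / ∏_{l ∈ active} (1 - x^(factor l)).
record Fraction (N d : ℕ) : Set where
  constructor fraction
  field
    num    : Laurent N
    active : Subset d
    factor : Fin d → Exponent N

open Fraction public

factors : Fraction N d → List (Exponent N)
factors E = List.map (factor E) (filter (_∈? active E) (allFin _))

∏binomial : List (Exponent N) → Laurent N
∏binomial = foldr (λ m f → binomial m *ᴸ f) 1ᴸ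

den : Fraction N d → Laurent N
den E = ∏binomial (factors E)

WellDefined : Fraction N d → Set
WellDefined E = ∀ {l} → l ∈ active E → factor E l ≢ 𝟘

-- Both sides denote fractional rational functions, and these are equal.
infix 4 _≈_
record _≈_ {N d d′ : ℕ} (E : Fraction N d) (F : Fraction N d′) : Set where
  constructor mk≈
  field
    definedˡ : WellDefined E
    definedʳ : WellDefined F
    cross    : num E *ᴸ den F ≐ num F *ᴸ den E

scale : ℚ → Fraction N d → Fraction N d
scale q E = record E { num = List.map (map₁ (q *ℚ_)) (num E) }

-- S stands for the formal sum of the S e · x^e.
Series : ℕ → Set
Series N = Exponent N → ℚ

infixr 7 _•_
_•_ : Laurent N → Series N → Series N
([]            • S) e = 0ℚ
(((c , m) ∷ f) • S) e = c *ℚ S (e ⊖ m) +ℚ (f • S) e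

weight : Vec ℚ N → Exponent N → ℚ
weight []      []      = 0ℚ
weight (w ∷ ws) (e ∷ es) = w *ℚ e +ℚ weight ws es

-- For fixed w the series with this property form an integral domain containing
-- the Laurent polynomials, in which 1 - x^m is invertible as soon as
-- weight w m ≢ 0: it is expanded in powers of x^m if weight w m > 0 and of
-- x^(-m) if weight w m < 0.  Choosing a series expansion means choosing w.
LocallyFinite : Vec ℚ N → Series N → Set
LocallyFinite w S = ∀ B → ∃[ es ] ∀ e → S e ≢ 0ℚ → weight w e ≤ B → e ∈ˡ es

record IsExpansion (w : Vec ℚ N) (S : Series N) (E : Fraction N d) : Set where
  constructor mkExpansion
  field
    locallyFinite : LocallyFinite w S
    solves        : ∀ e → (den E • S) e ≡ coeff (num E) e

Integral : ℚ → Set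
Integral q = ↧ₙ q ≡ 1

integral? : ∀ q → Dec (Integral q)
integral? (mkℚ _ zero    _) = yes refl
integral? (mkℚ _ (suc _) _) = no λ ()

keepIntegral : Fin N → Series N → Series N
keepIntegral y S e = if does (integral? (lookup e y)) then S e else 0ℚ

-- F is the result of applying 𝒵_y to E, whatever series expansion is used.
record Is𝒵 (y : Fin N) (E F : Fraction N d) : Set where
  constructor mkIs𝒵
  field
    defined : WellDefined E → WellDefined F
    expands : ∀ w S → IsExpansion w S E → IsExpansion w (keepIntegral y S) F

ι : ℤ → ℚ
ι z = z / 1

ι-+ : ∀ a b → ι (a ℤ.+ b) ≡ ι a +ℚ ι b
ι-+ a b = ℚ.toℚᵘ-injective $ ℚᵘ.≃-trans (ℚ.toℚᵘ-fromℚᵘ (mkℚᵘ (a ℤ.+ b) 0)) $ ℚᵘ.≃-sym $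
  ℚᵘ.≃-trans (ℚ.toℚᵘ-homo-+ (ι a) (ι b)) $
  ℚᵘ.≃-trans (ℚᵘ.+-cong (ℚ.toℚᵘ-fromℚᵘ (mkℚᵘ a 0)) (ℚ.toℚᵘ-fromℚᵘ (mkℚᵘ b 0))) $
  *≡* (cong (ℤ._* + 1) (cong₂ ℤ._+_ (ℤ.*-identityʳ a) (ℤ.*-identityʳ b)))

ι-neg : ∀ a → ι (ℤ.- a) ≡ -ℚ ι a
ι-neg a = ℚ.toℚᵘ-injective $ ℚᵘ.≃-trans (ℚ.toℚᵘ-fromℚᵘ (mkℚᵘ (ℤ.- a) 0)) $ ℚᵘ.≃-sym $
  ℚᵘ.≃-trans (ℚ.toℚᵘ-homo‿- (ι a)) $
  ℚᵘ.-‿cong (ℚ.toℚᵘ-fromℚᵘ (mkℚᵘ a 0))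

ι-clear : ∀ q → ι (↧ q) *ℚ q ≡ ι (↥ q)
ι-clear q@(mkℚ z k c) = ℚ.toℚᵘ-injective $
  ℚᵘ.≃-trans (ℚ.toℚᵘ-homo-* (ι (↧ q)) q) $
  ℚᵘ.≃-trans (ℚᵘ.*-cong (ℚ.toℚᵘ-fromℚᵘ (mkℚᵘ (↧ q) 0)) (ℚᵘ.≃-refl {mkℚᵘ z k})) $
  ℚᵘ.≃-trans (*≡* lem) (ℚᵘ.≃-sym (ℚ.toℚᵘ-fromℚᵘ (mkℚᵘ z 0)))
  where
  lem : (+ suc k ℤ.* z) ℤ.* + 1 ≡ z ℤ.* (+ 1 ℤ.* + suc k)
  lem = begin
    (+ suc k ℤ.* z) ℤ.* + 1   ≡⟨ ℤ.*-identityʳ _ ⟩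
    + suc k ℤ.* z             ≡⟨ ℤ.*-comm (+ suc k) z ⟩
    z ℤ.* + suc k             ≡⟨ cong (z ℤ.*_) (sym (ℤ.*-identityˡ _)) ⟩
    z ℤ.* (+ 1 ℤ.* + suc k)   ∎
    where open ≡-Reasoning

integral-ι : ∀ z → Integral (ι z)
integral-ι z = cong ↧ₙ_ (ℚ.↥p/↧p≡p (mkℚ z 0 (Coprimality.sym (Coprimality.1-coprimeTo _))))

integral⇒ι : ∀ q → Integral q → q ≡ ι (↥ q)
integral⇒ι q@(mkℚ z 0 c) refl = sym (ℚ.↥p/↧p≡p q)

integral-+ : ∀ {p q} → Integral p → Integral q → Integral (p +ℚ q)
integral-+ {p} {q} ip iq = subst Integral
  (trans (ι-+ (↥ p) (↥ q)) (sym (cong₂ _+ℚ_ (integral⇒ι p ip) (integral⇒ι q iq)))) (integral-ι (↥ p ℤ.+ ↥ q))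

integral-neg : ∀ {p} → Integral p → Integral (-ℚ p)
integral-neg {p} ip = subst Integral
  (trans (ι-neg (↥ p)) (cong -ℚ_ (sym (integral⇒ι p ip)))) (integral-ι (ℤ.- ↥ p))

sub-add : ∀ p q → (p -ℚ q) +ℚ q ≡ p
sub-add = solve 2 (λ p q → (p :+ (:- q)) :+ q := p) refl

add-sub : ∀ p q → (p +ℚ q) -ℚ q ≡ p
add-sub = solve 2 (λ p q → (p :+ q) :+ (:- q) := p) refl

integral-sub : ∀ p {q} → Integral q → does (integral? (p -ℚ q)) ≡ does (integral? p)
integral-sub p {q} iq with integral? p
... | yes ip = dec-true (integral? (p -ℚ q)) (integral-+ {p} ip (integral-neg {q} iq))
... | no ¬ip = dec-false (integral? (p -ℚ q))
  λ i → ¬ip (subst Integral (sub-add p q) (integral-+ {p -ℚ q} i iq))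

⊕-comm : (e f : Exponent N) → e ⊕ f ≡ f ⊕ e
⊕-comm = Vec.zipWith-comm ℚ.+-comm

⊖-⊕ : (e f g : Exponent N) → e ⊖ (f ⊕ g) ≡ (e ⊖ f) ⊖ g
⊖-⊕ []      []      []      = refl
⊖-⊕ (a ∷ e) (b ∷ f) (c ∷ g) = cong₂ _∷_
  (solve 3 (λ a b c → a :+ (:- (b :+ c)) := (a :+ (:- b)) :+ (:- c)) refl a b c) (⊖-⊕ e f g)

⊖-swap : (e f g : Exponent N) → (e ⊖ f) ⊖ g ≡ (e ⊖ g) ⊖ f
⊖-swap e f g = trans (sym (⊖-⊕ e f g)) (trans (cong (e ⊖_) (⊕-comm f g)) (⊖-⊕ e g f))

⊖-𝟘 : (e : Exponent N) → e ⊖ 𝟘 ≡ e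
⊖-𝟘 []      = refl
⊖-𝟘 (a ∷ e) = cong₂ _∷_ (ℚ.+-identityʳ a) (⊖-𝟘 e)

⊖-self : (e : Exponent N) → e ⊖ e ≡ 𝟘
⊖-self []      = refl
⊖-self (a ∷ e) = cong₂ _∷_ (ℚ.+-inverseʳ a) (⊖-self e)

⊖-⊕-cancel : (e f : Exponent N) → (e ⊖ f) ⊕ f ≡ e
⊖-⊕-cancel []      []      = refl
⊖-⊕-cancel (a ∷ e) (b ∷ f) = cong₂ _∷_ (sub-add a b) (⊖-⊕-cancel e f)

⊕-⊖-cancel : (e f : Exponent N) → (e ⊕ f) ⊖ f ≡ e
⊕-⊖-cancel []      []      = refl
⊕-⊖-cancel (a ∷ e) (b ∷ f) = cong₂ _∷_ (add-sub a b) (⊕-⊖-cancel e f)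

𝟘-⊕ : (e : Exponent N) → 𝟘 ⊕ e ≡ e
𝟘-⊕ = Vec.zipWith-identityˡ ℚ.+-identityˡ

_×ᵉ_ : ℕ → Exponent N → Exponent N
t ×ᵉ m = ι (+ t) ⊛ m

0×ᵉ : (m : Exponent N) → 0 ×ᵉ m ≡ 𝟘
0×ᵉ []      = refl
0×ᵉ (a ∷ m) = cong₂ _∷_ (ℚ.*-zeroˡ a) (0×ᵉ m)

ι-suc : ∀ t → ι (+ suc t) ≡ 1ℚ +ℚ ι (+ t)
ι-suc t = ι-+ (+ 1) (+ t)

suc×ᵉ : ∀ t (m : Exponent N) → suc t ×ᵉ m ≡ m ⊕ (t ×ᵉ m)
suc×ᵉ t []      = refl
suc×ᵉ t (a ∷ m) = cong₂ _∷_
  (trans (cong (_*ℚ a) (ι-suc t)) (solve 2 (λ t a → (con 1ℚ :+ t) :* a := a :+ t :* a) refl (ι (+ t)) a))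
  (suc×ᵉ t m)

lookup-⊖ : ∀ (e f : Exponent N) x → lookup (e ⊖ f) x ≡ lookup e x -ℚ lookup f x
lookup-⊖ e f x = Vec.lookup-zipWith _-ℚ_ x e f

lookup-×ᵉ : ∀ t (m : Exponent N) x → lookup (t ×ᵉ m) x ≡ ι (+ t) *ℚ lookup m x
lookup-×ᵉ t m x = Vec.lookup-map x _ m

×ᵉ-≢𝟘 : ∀ t (m : Exponent N) → m ≢ 𝟘 → suc t ×ᵉ m ≢ 𝟘
×ᵉ-≢𝟘 t m m≢𝟘 eq = m≢𝟘 (go m eq)
  where
  s = ι (+ suc t)
  instance
    s≢0 : NonZero s
    s≢0 = ℚ.pos⇒nonZero s {{ℚ.normalize-pos (suc t) 1}}
  cancel : ∀ a → s *ℚ a ≡ 0ℚ → a ≡ 0ℚ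
  cancel a sa≡0 = begin
    a                       ≡⟨ sym (ℚ.*-identityˡ a) ⟩
    1ℚ *ℚ a                 ≡⟨ cong (_*ℚ a) (sym (ℚ.*-inverseˡ s)) ⟩
    (1/ s *ℚ s) *ℚ a        ≡⟨ ℚ.*-assoc (1/ s) s a ⟩
    1/ s *ℚ (s *ℚ a)        ≡⟨ cong (1/ s *ℚ_) sa≡0 ⟩
    1/ s *ℚ 0ℚ              ≡⟨ ℚ.*-zeroʳ (1/ s) ⟩
    0ℚ                      ∎
    where open ≡-Reasoning
  go : ∀ {N} (m : Exponent N) → suc t ×ᵉ m ≡ 𝟘 → m ≡ 𝟘
  go []      eq = refl
  go (a ∷ m) eq = cong₂ _∷_ (cancel a (Vec.∷-injectiveˡ eq)) (go m (Vec.∷-injectiveʳ eq))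

infix 4 _≗ˢ_
_≗ˢ_ : Series N → Series N → Set
S ≗ˢ T = ∀ e → S e ≡ T e

transˢ : {S T U : Series N} → S ≗ˢ T → T ≗ˢ U → S ≗ˢ U
transˢ p q e = trans (p e) (q e)

symˢ : {S T : Series N} → S ≗ˢ T → T ≗ˢ S
symˢ p e = sym (p e)

•-cong : ∀ (f : Laurent N) {S T} → S ≗ˢ T → f • S ≗ˢ f • T
•-cong []            p e = refl
•-cong ((c , m) ∷ f) p e = cong₂ (λ a b → c *ℚ a +ℚ b) (p _) (•-cong f p e)

•-++ : ∀ (f g : Laurent N) S e → ((f +ᴸ g) • S) e ≡ (f • S) e +ℚ (g • S) e
•-++ []            g S e = sym (ℚ.+-identityˡ _)
•-++ ((c , m) ∷ f) g S e =
  trans (cong (c *ℚ S (e ⊖ m) +ℚ_) (•-++ f g S e)) (sym (ℚ.+-assoc (c *ℚ S (e ⊖ m)) _ _))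

•-term : ∀ c m (g : Laurent N) S e →
  (List.map (λ (c′ , m′) → c *ℚ c′ , m ⊕ m′) g • S) e ≡ c *ℚ (g • S) (e ⊖ m)
•-term c m []              S e = sym (ℚ.*-zeroʳ c)
•-term c m ((c′ , m′) ∷ g) S e = trans
  (cong₂ (λ a b → (c *ℚ c′) *ℚ S a +ℚ b) (⊖-⊕ e m m′) (•-term c m g S e))
  (solve 4 (λ c c′ s t → (c :* c′) :* s :+ c :* t := c :* (c′ :* s :+ t)) refl
    c c′ (S ((e ⊖ m) ⊖ m′)) ((g • S) (e ⊖ m)))

•-* : ∀ (f g : Laurent N) S → (f *ᴸ g) • S ≗ˢ f • (g • S)
•-* []            g S e = refl
•-* ((c , m) ∷ f) g S e = trans (•-++ (List.map _ g) (f *ᴸ g) S e)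
  (cong₂ _+ℚ_ (•-term c m g S e) (•-* f g S e))

•-distrib : ∀ (g : Laurent N) c m S T e →
  (g • (λ e → c *ℚ S (e ⊖ m) +ℚ T e)) e ≡ c *ℚ (g • S) (e ⊖ m) +ℚ (g • T) e
•-distrib []              c m S T e = solve 1 (λ c → con 0ℚ := c :* con 0ℚ :+ con 0ℚ) refl c
•-distrib ((c′ , m′) ∷ g) c m S T e = trans
  (cong₂ (λ a b → c′ *ℚ (c *ℚ S a +ℚ T (e ⊖ m′)) +ℚ b) (⊖-swap e m′ m) (•-distrib g c m S T e))
  (solve 6 (λ c c′ s t u v → c′ :* (c :* s :+ t) :+ (c :* u :+ v) := c :* (c′ :* s :+ u) :+ (c′ :* t :+ v)) refl
    c c′ (S ((e ⊖ m) ⊖ m′)) (T (e ⊖ m′)) ((g • S) (e ⊖ m)) ((g • T) e))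

•-zero : ∀ (g : Laurent N) e → (g • (λ _ → 0ℚ)) e ≡ 0ℚ
•-zero []            e = refl
•-zero ((c , m) ∷ g) e = trans (cong (c *ℚ 0ℚ +ℚ_) (•-zero g e))
  (solve 1 (λ c → c :* con 0ℚ :+ con 0ℚ := con 0ℚ) refl c)

•-comm : ∀ (f g : Laurent N) S → f • (g • S) ≗ˢ g • (f • S)
•-comm []            g S e = sym (•-zero g e)
•-comm ((c , m) ∷ f) g S e = trans (cong (c *ℚ (g • S) (e ⊖ m) +ℚ_) (•-comm f g S e))
  (sym (•-distrib g c m S (f • S) e))

δ : Series N
δ e = if does (e ≟ᵉ 𝟘) then 1ℚ else 0ℚ

δ-shift : ∀ c (e m : Exponent N) → (if does (e ≟ᵉ m) then c else 0ℚ) ≡ c *ℚ δ (e ⊖ m)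
δ-shift c e m with e ≟ᵉ m
... | yes refl rewrite dec-true ((e ⊖ e) ≟ᵉ 𝟘) (⊖-self e) = sym (ℚ.*-identityʳ c)
... | no e≢m rewrite dec-false ((e ⊖ m) ≟ᵉ 𝟘)
      (λ eq → e≢m (trans (sym (⊖-⊕-cancel e m)) (trans (cong (_⊕ m) eq) (𝟘-⊕ m)))) = sym (ℚ.*-zeroʳ c)

coeff-• : (f : Laurent N) → coeff f ≗ˢ f • δ
coeff-• []            e = refl
coeff-• ((c , m) ∷ f) e = cong₂ _+ℚ_ (δ-shift c e m) (coeff-• f e)

coeff-* : (f g : Laurent N) → coeff (f *ᴸ g) ≗ˢ f • coeff g
coeff-* f g = transˢ (coeff-• (f *ᴸ g)) (transˢ (•-* f g δ) (•-cong f (symˢ (coeff-• g))))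

*ᴸ-comm : (f g : Laurent N) → f *ᴸ g ≐ g *ᴸ f
*ᴸ-comm f g = transˢ (coeff-• (f *ᴸ g)) (transˢ (•-* f g δ) (transˢ (•-comm f g δ)
  (symˢ (transˢ (coeff-• (g *ᴸ f)) (•-* g f δ)))))

1•_ : (S : Series N) → 1ᴸ • S ≗ˢ S
(1• S) e = trans (cong (λ a → 1ℚ *ℚ S a +ℚ 0ℚ) (⊖-𝟘 e))
  (solve 1 (λ s → con 1ℚ :* s :+ con 0ℚ := s) refl (S e))

binomial-• : ∀ m (S : Series N) e → (binomial m • S) e ≡ S e -ℚ S (e ⊖ m)
binomial-• m S e = trans (cong (λ a → 1ℚ *ℚ S a +ℚ (-ℚ 1ℚ *ℚ S (e ⊖ m) +ℚ 0ℚ)) (⊖-𝟘 e))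
  (solve 2 (λ a b → con 1ℚ :* a :+ (:- con 1ℚ :* b :+ con 0ℚ) := a :+ (:- b)) refl (S e) (S (e ⊖ m)))

-- 1 + x^m + ⋯ + x^((t - 1) m)
geometric : ℕ → Exponent N → Laurent N
geometric zero    m = []
geometric (suc t) m = (1ℚ , (+ t / 1) ⊛ m) ∷ geometric t m

order : Fin N → Exponent N → ℕ
order y m = ↧ₙ (lookup m y)

keepIntegralᴸ : Fin N → Laurent N → Laurent N
keepIntegralᴸ y = filter (λ (_ , m) → integral? (lookup m y))

-- Each factor 1 - x^m is rewritten as (1 - x^(tm)) / (1 + x^m + ⋯ + x^((t-1)m)),
-- where t is the denominator of the exponent of y in m.
multisection : Fin N → Fraction N d → Fraction N d
multisection y E = fraction
  (keepIntegralᴸ y (foldr (λ m f → geometric (order y m) m *ᴸ f) (num E) (factors E)))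
  (active E)
  (λ l → (+ order y (factor E l) / 1) ⊛ factor E l)

geometric-• : ∀ t m (S : Series N) → binomial (t ×ᵉ m) • S ≗ˢ geometric t m • (binomial m • S)
geometric-• zero m S e = trans (binomial-• (0 ×ᵉ m) S e)
  (trans (cong (λ a → S e -ℚ S a) (trans (cong (e ⊖_) (0×ᵉ m)) (⊖-𝟘 e))) (ℚ.+-inverseʳ (S e)))
geometric-• (suc t) m S e = begin
  (binomial (suc t ×ᵉ m) • S) e
    ≡⟨ binomial-• (suc t ×ᵉ m) S e ⟩
  S e -ℚ S (e ⊖ (suc t ×ᵉ m))
    ≡⟨ cong (λ a → S e -ℚ S a) (trans (cong (e ⊖_) (trans (suc×ᵉ t m) (⊕-comm m _))) (⊖-⊕ e (t ×ᵉ m) m)) ⟩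
  S e -ℚ S ((e ⊖ (t ×ᵉ m)) ⊖ m)
    ≡⟨ solve 3 (λ a b c → a :+ (:- c) := con 1ℚ :* (b :+ (:- c)) :+ (a :+ (:- b))) refl
         (S e) (S (e ⊖ (t ×ᵉ m))) (S ((e ⊖ (t ×ᵉ m)) ⊖ m)) ⟩
  1ℚ *ℚ (S (e ⊖ (t ×ᵉ m)) -ℚ S ((e ⊖ (t ×ᵉ m)) ⊖ m)) +ℚ (S e -ℚ S (e ⊖ (t ×ᵉ m)))
    ≡⟨ cong₂ (λ a b → 1ℚ *ℚ a +ℚ b) (sym (binomial-• m S (e ⊖ (t ×ᵉ m))))
         (trans (sym (binomial-• (t ×ᵉ m) S e)) (geometric-• t m S e)) ⟩
  1ℚ *ℚ (binomial m • S) (e ⊖ (t ×ᵉ m)) +ℚ (geometric t m • (binomial m • S)) e ∎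
  where open ≡-Reasoning

∏geometric-• : ∀ y (ms : List (Exponent N)) {S} f → ∏binomial ms • S ≗ˢ coeff f →
  ∏binomial (List.map (λ m → order y m ×ᵉ m) ms) • S
    ≗ˢ coeff (foldr (λ m f → geometric (order y m) m *ᴸ f) f ms)
∏geometric-• {N} y ms {S} f p = transˢ (go ms S) (transˢ (G-cong ms p) (symˢ (G-coeff ms)))
  where
  G : List (Exponent N) → Series N → Series N
  G []       T = T
  G (m ∷ ms) T = geometric (order y m) m • G ms T
  G-cong : ∀ ms {T U} → T ≗ˢ U → G ms T ≗ˢ G ms U
  G-cong []       p = p
  G-cong (m ∷ ms) p = •-cong (geometric (order y m) m) (G-cong ms p)
  G-• : ∀ ms g T → G ms (g • T) ≗ˢ g • G ms T
  G-• []       g T e = refl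
  G-• (m ∷ ms) g T = transˢ (•-cong (geometric (order y m) m) (G-• ms g T)) (•-comm (geometric (order y m) m) g (G ms T))
  G-coeff : ∀ ms → coeff (foldr (λ m f → geometric (order y m) m *ᴸ f) f ms) ≗ˢ G ms (coeff f)
  G-coeff []       e = refl
  G-coeff (m ∷ ms) = transˢ (coeff-* (geometric (order y m) m) (foldr (λ m f → geometric (order y m) m *ᴸ f) f ms)) (•-cong (geometric (order y m) m) (G-coeff ms))
  go : ∀ ms S → ∏binomial (List.map (λ m → order y m ×ᵉ m) ms) • S ≗ˢ G ms (∏binomial ms • S)
  go []       S e = refl
  go (m ∷ ms) S = transˢ (•-* (binomial (order y m ×ᵉ m)) (∏binomial (List.map (λ m → order y m ×ᵉ m) ms)) S)
    (transˢ (•-cong (binomial (order y m ×ᵉ m)) (go ms S))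
    (transˢ (geometric-• (order y m) m (G ms (∏binomial ms • S)))
    (•-cong (geometric (order y m) m)
      (transˢ (symˢ (G-• ms (binomial m) (∏binomial ms • S)))
        (G-cong ms (symˢ (•-* (binomial m) (∏binomial ms) S)))))))

IntegralIn : Fin N → Laurent N → Set
IntegralIn y = All (λ (_ , m) → Integral (lookup m y))

keep-• : ∀ y (f : Laurent N) S → IntegralIn y f →
  f • keepIntegral y S ≗ˢ keepIntegral y (f • S)
keep-• y []            S []       e with does (integral? (lookup e y))
... | true  = refl
... | false = refl
keep-• y ((c , m) ∷ f) S (im ∷ i) e
  rewrite keep-• y f S i e | lookup-⊖ e m y | integral-sub (lookup e y) {lookup m y} im
  with does (integral? (lookup e y))
... | true  = refl
... | false = solve 1 (λ c → c :* con 0ℚ :+ con 0ℚ := con 0ℚ) refl c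

coeff-keep : ∀ y (f : Laurent N) → coeff (keepIntegralᴸ y f) ≗ˢ keepIntegral y (coeff f)
coeff-keep y [] e with does (integral? (lookup e y))
... | true  = refl
... | false = refl
coeff-keep y ((c , m) ∷ f) e with integral? (lookup m y)
... | yes im rewrite coeff-keep y f e with e ≟ᵉ m
...   | yes refl rewrite dec-true (integral? (lookup e y)) im = refl
...   | no  _    with does (integral? (lookup e y))
...     | true  = refl
...     | false = refl
coeff-keep y ((c , m) ∷ f) e | no ¬im rewrite coeff-keep y f e with e ≟ᵉ m
...   | yes refl rewrite dec-false (integral? (lookup e y)) ¬im = refl
...   | no  _    with does (integral? (lookup e y))
...     | true  = sym (ℚ.+-identityˡ _)
...     | false = refl

*ᴸ-integral : ∀ y {f g : Laurent N} → IntegralIn y f → IntegralIn y g → IntegralIn y (f *ᴸ g)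
*ᴸ-integral y []                       jg = []
*ᴸ-integral {N} y {(c , m) ∷ f} {g} (im ∷ i) jg = append jg (*ᴸ-integral y i jg)
  where
  append : ∀ {g h : Laurent N} → IntegralIn y g → IntegralIn y h →
    IntegralIn y (List.map (λ (c′ , m′) → c *ℚ c′ , m ⊕ m′) g +ᴸ h)
  append []                        ih = ih
  append {(_ , m′) ∷ _} (im′ ∷ ig) ih =
    subst Integral (sym (Vec.lookup-zipWith _+ℚ_ y m m′)) (integral-+ {lookup m y} {lookup m′ y} im im′) ∷ append ig ih

integral-𝟘 : ∀ y → Integral (lookup {n = N} 𝟘 y)
integral-𝟘 y = cong ↧ₙ_ (Vec.lookup-replicate y 0ℚ)

integral-order : ∀ y (m : Exponent N) → Integral (lookup (order y m ×ᵉ m) y)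
integral-order y m = subst Integral
  (sym (trans (lookup-×ᵉ (order y m) m y) (ι-clear (lookup m y)))) (integral-ι (↥ lookup m y))

∏-integral : ∀ y (ms : List (Exponent N)) → IntegralIn y (∏binomial (List.map (λ m → order y m ×ᵉ m) ms))
∏-integral y []       = integral-𝟘 y ∷ []
∏-integral y (m ∷ ms) = *ᴸ-integral y {binomial (order y m ×ᵉ m)} (integral-𝟘 y ∷ integral-order y m ∷ []) (∏-integral y ms)

keep-support : ∀ y (S : Series N) e → keepIntegral y S e ≢ 0ℚ → S e ≢ 0ℚ
keep-support y S e ne eq with does (integral? (lookup e y))
... | true  = ne eq
... | false = ne refl

map-factor : ∀ y (E : Fraction N d) → factors (multisection y E) ≡ List.map (λ m → order y m ×ᵉ m) (factors E)
map-factor y E = go (filter (_∈? active E) (allFin _))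
  where
  go : ∀ ls → List.map (factor (multisection y E)) ls ≡ List.map (λ m → order y m ×ᵉ m) (List.map (factor E) ls)
  go []       = refl
  go (l ∷ ls) = cong (_ ∷_) (go ls)

multisection-is𝒵 : ∀ y (E : Fraction N d) → Is𝒵 y E (multisection y E)
multisection-is𝒵 y E = mkIs𝒵
  (λ wd {l} l∈ → ×ᵉ-≢𝟘 (ℚ.denominator-1 (lookup (factor E l) y)) (factor E l) (wd l∈))
  λ w S (mkExpansion lf sol) → mkExpansion
    (λ B → map₂ (λ h e ne → h e (keep-support y S e ne)) (lf B))
    (transˢ (λ e → cong (λ ms → (∏binomial ms • keepIntegral y S) e) (map-factor y E))
    (transˢ (keep-• y (∏binomial (List.map (λ m → order y m ×ᵉ m) (factors E))) S (∏-integral y (factors E)))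
    (transˢ (λ e → cong (λ s → if does (integral? (lookup e y)) then s else 0ℚ)
              (∏geometric-• y (factors E) (num E) sol e))
    (symˢ (coeff-keep y (foldr (λ m f → geometric (order y m) m *ᴸ f) (num E) (factors E)))))))

𝒵-exists : ∀ y (E : Fraction N d) → ∃[ F ] Is𝒵 y E F
𝒵-exists y E = multisection y E , multisection-is𝒵 y E

weight-𝟘ˡ : (e : Exponent N) → weight 𝟘 e ≡ 0ℚ
weight-𝟘ˡ []      = refl
weight-𝟘ˡ (a ∷ e) = trans (cong (0ℚ *ℚ a +ℚ_) (weight-𝟘ˡ e))
  (solve 1 (λ a → con 0ℚ :* a :+ con 0ℚ := con 0ℚ) refl a)

weight-⊖ : ∀ w (e f : Exponent N) → weight w (e ⊖ f) ≡ weight w e -ℚ weight w f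
weight-⊖ []      []      []      = refl
weight-⊖ (w ∷ ws) (a ∷ e) (b ∷ f) = trans (cong (w *ℚ (a -ℚ b) +ℚ_) (weight-⊖ ws e f))
  (solve 5 (λ w a b x y → w :* (a :+ (:- b)) :+ (x :+ (:- y)) := (w :* a :+ x) :+ (:- (w :* b :+ y))) refl
    w a b (weight ws e) (weight ws f))

weight-⊛ : ∀ w q (e : Exponent N) → weight w (q ⊛ e) ≡ q *ℚ weight w e
weight-⊛ []       q []      = sym (ℚ.*-zeroʳ q)
weight-⊛ (w ∷ ws) q (a ∷ e) = trans (cong (w *ℚ (q *ℚ a) +ℚ_) (weight-⊛ ws q e))
  (solve 4 (λ w q a x → w :* (q :* a) :+ q :* x := q :* (w :* a :+ x)) refl w q a (weight ws e))

weight-+ : ∀ w t u (e : Exponent N) →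
  weight (Vec.zipWith (λ a b → a +ℚ t *ℚ b) w u) e ≡ weight w e +ℚ t *ℚ weight u e
weight-+ []       t []       []      = sym (trans (ℚ.+-identityˡ _) (ℚ.*-zeroʳ t))
weight-+ (w ∷ ws) t (u ∷ us) (a ∷ e) = trans (cong ((w +ℚ t *ℚ u) *ℚ a +ℚ_) (weight-+ ws t us e))
  (solve 6 (λ w t u a x y → (w :+ t :* u) :* a :+ (x :+ t :* y) := (w :* a :+ x) :+ t :* (u :* a :+ y)) refl
    w t u a (weight ws e) (weight us e))

separate : (m : Exponent N) → m ≢ 𝟘 → ∃[ u ] weight u m ≢ 0ℚ
separate []      m≢𝟘 = contradiction refl m≢𝟘
separate (a ∷ m) m≢𝟘 with a ℚ.≟ 0ℚ
... | no a≢0 = 1ℚ ∷ 𝟘 , λ eq → a≢0 (trans (sym (trans (cong (1ℚ *ℚ a +ℚ_) (weight-𝟘ˡ m))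
                 (solve 1 (λ a → con 1ℚ :* a :+ con 0ℚ := a) refl a))) eq)
... | yes refl with separate m (λ { refl → m≢𝟘 refl })
...   | u , ne = 0ℚ ∷ u , λ eq → ne (trans (sym (ℚ.+-identityˡ _)) eq)

avoid₁ : ∀ a b → a ≢ 0ℚ ⊎ b ≢ 0ℚ → ∃[ s ] ∀ t → s < t → a +ℚ t *ℚ b ≢ 0ℚ
avoid₁ a b ne with b ℚ.≟ 0ℚ
avoid₁ a b (inj₁ a≢0) | yes refl = 0ℚ , λ t _ eq → a≢0 (trans
  (solve 2 (λ a t → a := a :+ t :* con 0ℚ) refl a t) eq)
avoid₁ a b (inj₂ b≢0) | yes b≡0  = contradiction b≡0 b≢0
avoid₁ a b _          | no b≢0   = (-ℚ a) *ℚ 1/b , λ t s<t eq → ℚ.<-irrefl (sym (root t eq)) s<t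
  where
  instance
    nz : NonZero b
    nz = ℚ.≢-nonZero b≢0
  1/b = 1/ b
  root : ∀ t → a +ℚ t *ℚ b ≡ 0ℚ → t ≡ (-ℚ a) *ℚ 1/b
  root t eq = begin
    t                                      ≡⟨ sym (ℚ.*-identityʳ t) ⟩
    t *ℚ 1ℚ                                ≡⟨ cong (t *ℚ_) (sym (ℚ.*-inverseʳ b)) ⟩
    t *ℚ (b *ℚ 1/b)                        ≡⟨ solve 4 (λ a b c t → t :* (b :* c) := (a :+ t :* b) :* c :+ (:- a) :* c) refl a b 1/b t ⟩
    (a +ℚ t *ℚ b) *ℚ 1/b +ℚ (-ℚ a) *ℚ 1/b  ≡⟨ cong (λ z → z *ℚ 1/b +ℚ (-ℚ a) *ℚ 1/b) eq ⟩
    0ℚ *ℚ 1/b +ℚ (-ℚ a) *ℚ 1/b             ≡⟨ solve 2 (λ c x → con 0ℚ :* c :+ x := x) refl 1/b ((-ℚ a) *ℚ 1/b) ⟩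
    (-ℚ a) *ℚ 1/b                          ∎
    where open ≡-Reasoning

avoid : ∀ {A : Set} (f g : A → ℚ) xs → All (λ x → f x ≢ 0ℚ ⊎ g x ≢ 0ℚ) xs →
  ∃[ s ] ∀ t → s < t → All (λ x → f x +ℚ t *ℚ g x ≢ 0ℚ) xs
avoid f g []       []       = 0ℚ , λ _ _ → []
avoid f g (x ∷ xs) (p ∷ ps) with avoid₁ (f x) (g x) p | avoid f g xs ps
... | s , h | s′ , h′ = s ℚ.⊔ s′ , λ t lt →
  h t (ℚ.≤-<-trans (ℚ.p≤p⊔q s s′) lt) ∷ h′ t (ℚ.≤-<-trans (ℚ.p≤q⊔p s s′) lt)

s<s+1 : ∀ s → s < s +ℚ 1ℚ
s<s+1 s = subst (_< s +ℚ 1ℚ) (ℚ.+-identityʳ s) (ℚ.+-monoʳ-< s (ℚ.positive⁻¹ 1ℚ))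

generic : (ms : List (Exponent N)) → All (_≢ 𝟘) ms → ∃[ w ] All (λ m → weight w m ≢ 0ℚ) ms
generic []       []       = 𝟘 , []
generic (m ∷ ms) (p ∷ ps) with generic ms ps | separate m p
... | w , h | u , ne with avoid (weight w) (weight u) (m ∷ ms) (inj₂ ne ∷ All.map inj₁ h)
...   | s , k = Vec.zipWith (λ a b → a +ℚ (s +ℚ 1ℚ) *ℚ b) w u
              , All.map (λ {m′} q eq → q (trans (sym (weight-+ w (s +ℚ 1ℚ) u m′)) eq)) (k (s +ℚ 1ℚ) (s<s+1 s))

0≤ι : ∀ k → 0ℚ ≤ ι (+ k)
0≤ι k = ℚ.nonNegative⁻¹ (ι (+ k)) {{ℚ.normalize-nonNeg k 1}}

ι-mono : ∀ {j k} → j ℕ.≤ k → ι (+ j) ≤ ι (+ k)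
ι-mono {j} {k} j≤k = begin
  ι (+ j)                       ≡⟨ sym (ℚ.+-identityʳ _) ⟩
  ι (+ j) +ℚ 0ℚ                 ≤⟨ ℚ.+-monoʳ-≤ (ι (+ j)) (0≤ι (k ℕ.∸ j)) ⟩
  ι (+ j) +ℚ ι (+ (k ℕ.∸ j))    ≡⟨ sym (ι-+ (+ j) (+ (k ℕ.∸ j))) ⟩
  ι (+ j ℤ.+ + (k ℕ.∸ j))       ≡⟨ cong (λ i → ι (+ i)) (ℕ.m+[n∸m]≡n j≤k) ⟩
  ι (+ k)                       ∎
  where open ℚ.≤-Reasoning

below : ∀ q → ∃[ K ] q < ι (+ K)
below q@(mkℚ z k _) = suc ℤ.∣ z ∣ , subst (q <_)
  (sym (ℚ.↥p/↧p≡p (mkℚ (+ suc ℤ.∣ z ∣) 0 (Coprimality.sym (Coprimality.1-coprimeTo _))))) (ℚ.*<* lem)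
  where
  open ℤ.≤-Reasoning
  lem : z ℤ.* + 1 ℤ.< + suc ℤ.∣ z ∣ ℤ.* + suc k
  lem = begin-strict
    z ℤ.* + 1                   ≡⟨ ℤ.*-identityʳ z ⟩
    z                           ≤⟨ i≤∣i∣ z ⟩
    + ℤ.∣ z ∣                   <⟨ ℤ.+<+ ℕ.≤-refl ⟩
    + suc ℤ.∣ z ∣               ≤⟨ ℤ.+≤+ (ℕ.m≤m*n (suc ℤ.∣ z ∣) (suc k)) ⟩
    + (suc ℤ.∣ z ∣ ℕ.* suc k)   ≡⟨ ℤ.pos-* (suc ℤ.∣ z ∣) (suc k) ⟩
    + suc ℤ.∣ z ∣ ℤ.* + suc k   ∎
    where
    i≤∣i∣ : ∀ i → i ℤ.≤ + ℤ.∣ i ∣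
    i≤∣i∣ (+ _)      = ℤ.≤-refl
    i≤∣i∣ (-[1+ _ ]) = ℤ.-≤+

archimedean : ∀ {a} → 0ℚ < a → ∀ x → ∃[ K ] ∀ {k} → K ℕ.≤ k → x < ι (+ k) *ℚ a
archimedean {a} 0<a x with below (x *ℚ 1/ a)
  where instance _ = ℚ.>-nonZero 0<a
... | K , lt = K , λ {k} K≤k → subst (_< ι (+ k) *ℚ a) back
                 (ℚ.*-monoˡ-<-pos a (ℚ.<-≤-trans lt (ι-mono K≤k)))
  where
  instance
    _ = ℚ.>-nonZero 0<a
    _ = ℚ.positive 0<a
  back : (x *ℚ 1/ a) *ℚ a ≡ x
  back = trans (ℚ.*-assoc x (1/ a) a) (trans (cong (x *ℚ_) (ℚ.*-inverseˡ a)) (ℚ.*-identityʳ x))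

lowerBound : ∀ w (S : Series N) → LocallyFinite w S → ∃[ c ] ∀ e → S e ≢ 0ℚ → c ≤ weight w e
lowerBound {N} w S lf = c es , bound
  where
  es = proj₁ (lf 0ℚ)
  h  = proj₂ (lf 0ℚ)
  c : List (Exponent N) → ℚ
  c = foldr (λ e b → weight w e ℚ.⊓ b) 0ℚ
  c≤0 : ∀ es → c es ≤ 0ℚ
  c≤0 []       = ℚ.≤-refl
  c≤0 (e ∷ es) = ℚ.≤-trans (ℚ.p⊓q≤q (weight w e) (c es)) (c≤0 es)
  ∈⇒≥ : ∀ es {e} → e ∈ˡ es → c es ≤ weight w e
  ∈⇒≥ (e ∷ es) (here refl) = ℚ.p⊓q≤p (weight w e) (c es)
  ∈⇒≥ (e ∷ es) (there e∈)  = ℚ.≤-trans (ℚ.p⊓q≤q (weight w e) (c es)) (∈⇒≥ es e∈)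

  bound : ∀ e → S e ≢ 0ℚ → c es ≤ weight w e
  bound e ne with ℚ.≤-total (weight w e) 0ℚ
  ... | inj₁ w≤0 = ∈⇒≥ es (h e ne w≤0)
  ... | inj₂ 0≤w = ℚ.≤-trans (c≤0 es) 0≤w

weight-shift : ∀ w k (m e : Exponent N) → weight w (e ⊖ (k ×ᵉ m)) ≡ weight w e -ℚ ι (+ k) *ℚ weight w m
weight-shift w k m e = trans (weight-⊖ w e (k ×ᵉ m)) (cong (λ x → weight w e -ℚ x) (weight-⊛ w (ι (+ k)) m))

module Positive (w : Vec ℚ N) (m : Exponent N) (0<m : 0ℚ < weight w m)
                (S : Series N) (lf : LocallyFinite w S) where
  a = weight w m
  c = proj₁ (lowerBound w S lf)

  c≤ : ∀ e → S e ≢ 0ℚ → c ≤ weight w e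
  c≤ = proj₂ (lowerBound w S lf)

  too-low : ∀ B k e → weight w e ≤ B → B -ℚ c < ι (+ k) *ℚ a → S (e ⊖ (k ×ᵉ m)) ≡ 0ℚ
  too-low B k e e≤B lt with S (e ⊖ (k ×ᵉ m)) ℚ.≟ 0ℚ
  ... | yes eq = eq
  ... | no  ne = ⊥-elim (ℚ.<-irrefl refl (ℚ.≤-<-trans (c≤ (e ⊖ (k ×ᵉ m)) ne) (begin-strict
    weight w (e ⊖ (k ×ᵉ m))       ≡⟨ weight-shift w k m e ⟩
    weight w e -ℚ x               ≤⟨ ℚ.+-monoˡ-≤ (-ℚ x) e≤B ⟩
    B -ℚ x                        ≡⟨ solve 3 (λ B c x → B :+ (:- x) := (B :+ (:- c)) :+ (c :+ (:- x))) refl B c x ⟩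
    (B -ℚ c) +ℚ (c -ℚ x)          <⟨ ℚ.+-monoˡ-< (c -ℚ x) lt ⟩
    x +ℚ (c -ℚ x)                 ≡⟨ solve 2 (λ c x → x :+ (c :+ (:- x)) := c) refl c x ⟩
    c                             ∎)))
    where
    open ℚ.≤-Reasoning
    x = ι (+ k) *ℚ a

  K : ℚ → ℕ
  K B = proj₁ (archimedean 0<m (B -ℚ c))

  vanish : ∀ B {k} e → weight w e ≤ B → K B ℕ.≤ k → S (e ⊖ (k ×ᵉ m)) ≡ 0ℚ
  vanish B {k} e e≤B K≤k = too-low B k e e≤B (proj₂ (archimedean 0<m (B -ℚ c)) K≤k)

  partial : ℕ → Series N
  partial zero    e = 0ℚ
  partial (suc n) e = partial n e +ℚ S (e ⊖ (n ×ᵉ m))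

  T : Series N
  T e = partial (K (weight w e)) e

  stable : ∀ e j → partial (j ℕ.+ K (weight w e)) e ≡ T e
  stable e zero    = refl
  stable e (suc j) = trans
    (cong₂ _+ℚ_ (stable e j) (vanish (weight w e) e ℚ.≤-refl (ℕ.m≤n+m (K (weight w e)) j)))
    (ℚ.+-identityʳ (T e))

  stable-≤ : ∀ e {n} → K (weight w e) ℕ.≤ n → partial n e ≡ T e
  stable-≤ e {n} K≤n = trans (cong (λ i → partial i e) (sym (ℕ.m∸n+n≡m K≤n))) (stable e (n ℕ.∸ K (weight w e)))

  telescope : ∀ n e → partial (suc n) e ≡ S e +ℚ partial n (e ⊖ m)
  telescope zero    e = trans (cong (λ f → 0ℚ +ℚ S f) (trans (cong (e ⊖_) (0×ᵉ m)) (⊖-𝟘 e)))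
    (ℚ.+-comm 0ℚ (S e))
  telescope (suc n) e = trans (cong₂ _+ℚ_ (telescope n e)
      (cong S (trans (cong (e ⊖_) (suc×ᵉ n m)) (⊖-⊕ e m (n ×ᵉ m)))))
    (ℚ.+-assoc (S e) (partial n (e ⊖ m)) (S ((e ⊖ m) ⊖ (n ×ᵉ m))))

  solves : binomial m • T ≗ˢ S
  solves e = trans (binomial-• m T e) (trans (cong (_-ℚ T (e ⊖ m)) step) (add-sub (S e) (T (e ⊖ m))))
    where
    M = K (weight w e) ℕ.+ K (weight w (e ⊖ m))
    step : T e ≡ S e +ℚ T (e ⊖ m)
    step = begin
      T e                       ≡⟨ sym (stable-≤ e (ℕ.m≤n⇒m≤1+n (ℕ.m≤m+n _ _))) ⟩
      partial (suc M) e         ≡⟨ telescope M e ⟩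
      S e +ℚ partial M (e ⊖ m)  ≡⟨ cong (S e +ℚ_) (stable-≤ (e ⊖ m) {M} (ℕ.m≤n+m (K (weight w (e ⊖ m))) (K (weight w e)))) ⟩
      S e +ℚ T (e ⊖ m)          ∎
      where open ≡-Reasoning

  contributes : ∀ n e → partial n e ≢ 0ℚ → ∃[ k ] S (e ⊖ (k ×ᵉ m)) ≢ 0ℚ
  contributes zero    e ne = contradiction refl ne
  contributes (suc n) e ne with S (e ⊖ (n ×ᵉ m)) ℚ.≟ 0ℚ
  ... | no  ne′ = n , ne′
  ... | yes eq  = contributes n e λ eq′ → ne (cong₂ _+ℚ_ eq′ eq)

  finite : LocallyFinite w T
  finite B = cartesianProductWith (λ e k → e ⊕ (k ×ᵉ m)) es (upTo (K B)) , λ e ne e≤B →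
    let k , ne′ = contributes (K (weight w e)) e ne
        k<K = ℕ.≰⇒> λ K≤k → ne′ (vanish B e e≤B K≤k)
        e′≤B = ℚ.≤-trans (lower e k) e≤B
    in subst (_∈ˡ cartesianProductWith (λ e k → e ⊕ (k ×ᵉ m)) es (upTo (K B))) (⊖-⊕-cancel e (k ×ᵉ m))
         (∈-cartesianProductWith⁺ (λ e k → e ⊕ (k ×ᵉ m)) {a = e ⊖ (k ×ᵉ m)} {b = k} (h (e ⊖ (k ×ᵉ m)) ne′ e′≤B) (∈-upTo⁺ k<K))
    where
    es = proj₁ (lf B)
    h  = proj₂ (lf B)
    instance
      _ = ℚ.positive 0<m
      _ = ℚ.pos⇒nonNeg a
    lower : ∀ e k → weight w (e ⊖ (k ×ᵉ m)) ≤ weight w e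
    lower e k = begin
      weight w (e ⊖ (k ×ᵉ m))         ≡⟨ weight-shift w k m e ⟩
      weight w e -ℚ ι (+ k) *ℚ a      ≤⟨ ℚ.+-monoʳ-≤ (weight w e) (ℚ.neg-antimono-≤
                                           (subst (_≤ ι (+ k) *ℚ a) (ℚ.*-zeroˡ a) (ℚ.*-monoʳ-≤-nonNeg a (0≤ι k)))) ⟩
      weight w e +ℚ 0ℚ                ≡⟨ ℚ.+-identityʳ _ ⟩
      weight w e                      ∎
      where open ℚ.≤-Reasoning

⊖-neg : (e m : Exponent N) → (e ⊖ m) ⊖ (𝟘 ⊖ m) ≡ e
⊖-neg []      []      = refl
⊖-neg (a ∷ e) (b ∷ m) = cong₂ _∷_
  (solve 2 (λ a b → (a :+ (:- b)) :+ (:- (con 0ℚ :+ (:- b))) := a) refl a b) (⊖-neg e m)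

⊖-neg′ : (e m : Exponent N) → (e ⊖ (𝟘 ⊖ m)) ⊖ m ≡ e
⊖-neg′ e m = trans (⊖-swap e (𝟘 ⊖ m) m) (⊖-neg e m)

weight-𝟘ʳ : (w : Vec ℚ N) → weight w 𝟘 ≡ 0ℚ
weight-𝟘ʳ []       = refl
weight-𝟘ʳ (w ∷ ws) = trans (cong (w *ℚ 0ℚ +ℚ_) (weight-𝟘ʳ ws))
  (solve 1 (λ w → w :* con 0ℚ :+ con 0ℚ := con 0ℚ) refl w)

divide : ∀ w (m : Exponent N) S → LocallyFinite w S → weight w m ≢ 0ℚ →
  ∃[ T ] LocallyFinite w T × binomial m • T ≗ˢ S
divide w m S lf ne with ℚ.<-cmp 0ℚ (weight w m)
... | tri< 0<m _ _ = T , finite , solves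
  where open Positive w m 0<m S lf
... | tri≈ _ eq _ = contradiction (sym eq) ne
... | tri> _ _ m<0 = T′ , finite′ , solves′
  where
  m′ = 𝟘 ⊖ m
  w-m′ : weight w m′ ≡ -ℚ weight w m
  w-m′ = trans (weight-⊖ w 𝟘 m) (trans (cong (_-ℚ weight w m) (weight-𝟘ʳ w)) (ℚ.+-identityˡ _))
  open Positive w m′ (subst (0ℚ <_) (sym w-m′) (ℚ.neg-antimono-< m<0)) S lf
  T′ : Series _
  T′ e = -ℚ T (e ⊖ m′)
  solves′ : binomial m • T′ ≗ˢ S
  solves′ e = begin
    (binomial m • T′) e                            ≡⟨ binomial-• m T′ e ⟩
    (-ℚ T (e ⊖ m′)) -ℚ (-ℚ T ((e ⊖ m) ⊖ m′))       ≡⟨ cong (λ f → (-ℚ T (e ⊖ m′)) -ℚ (-ℚ T f)) (⊖-neg e m) ⟩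
    (-ℚ T (e ⊖ m′)) -ℚ (-ℚ T e)                    ≡⟨ solve 2 (λ x y → (:- x) :+ (:- (:- y)) := y :+ (:- x)) refl (T (e ⊖ m′)) (T e) ⟩
    T e -ℚ T (e ⊖ m′)                              ≡⟨ sym (binomial-• m′ T e) ⟩
    (binomial m′ • T) e                            ≡⟨ solves e ⟩
    S e                                            ∎
    where open ≡-Reasoning
  finite′ : LocallyFinite w T′
  finite′ B = List.map (_⊖ m) (proj₁ (finite (B +ℚ weight w m))) , λ e ne′ e≤B →
    subst (_∈ˡ List.map (_⊖ m) (proj₁ (finite (B +ℚ weight w m)))) (⊖-neg′ e m) (∈-map⁺ (_⊖ m) (proj₂ (finite (B +ℚ weight w m)) (e ⊖ m′)
      (λ eq → ne′ (cong -ℚ_ eq))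
      (subst (_≤ B +ℚ weight w m)
        (sym (trans (weight-⊖ w e m′) (trans (cong (λ x → weight w e -ℚ x) w-m′)
          (solve 2 (λ x y → x :+ (:- (:- y)) := x :+ y) refl (weight w e) (weight w m)))))
        (ℚ.+-monoˡ-≤ (weight w m) e≤B))))

divide-all : ∀ w (ms : List (Exponent N)) S → LocallyFinite w S → All (λ m → weight w m ≢ 0ℚ) ms →
  ∃[ T ] LocallyFinite w T × ∏binomial ms • T ≗ˢ S
divide-all w []       S lf []       = S , lf , 1• S
divide-all w (m ∷ ms) S lf (p ∷ ps) with divide w m S lf p
... | U , lfU , solU with divide-all w ms U lfU ps
...   | T , lfT , solT = T , lfT ,
  transˢ (•-* (binomial m) (∏binomial ms) T) (transˢ (•-cong (binomial m) solT) solU)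

coeff-support : (f : Laurent N) → ∀ e → coeff f e ≢ 0ℚ → e ∈ˡ List.map proj₂ f
coeff-support []            e ne = contradiction refl ne
coeff-support ((c , m) ∷ f) e ne with e ≟ᵉ m
... | yes e≡m = here e≡m
... | no  _   = there (coeff-support f e λ eq → ne (trans (ℚ.+-identityˡ _) eq))

expansion-exists : (E : Fraction N d) → WellDefined E → ∃[ w ] ∃[ S ] IsExpansion w S E
expansion-exists E wd =
  let w , g = generic (factors E) (All.tabulate nonzero)
      T , lf , sol = divide-all w (factors E) (coeff (num E)) (finite w) g
  in w , T , mkExpansion lf sol
  where
  finite : ∀ w → LocallyFinite w (coeff (num E))
  finite w B = List.map proj₂ (num E) , λ e ne _ → coeff-support (num E) e ne
  nonzero : ∀ {m} → m ∈ˡ factors E → m ≢ 𝟘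
  nonzero m∈ with ∈-map⁻ (factor E) m∈
  ... | l , l∈ , refl = wd (proj₂ (∈-filter⁻ (_∈? active E) {xs = allFin _} l∈))

𝒵-unique : ∀ {y} {E F G : Fraction N d} → WellDefined E → Is𝒵 y E F → Is𝒵 y E G → F ≈ G
𝒵-unique {y = y} {E} {F} {G} wd (mkIs𝒵 wdF expF) (mkIs𝒵 wdG expG) with expansion-exists E wd
... | w , S , ex = mk≈ (wdF wd) (wdG wd)
  (transˢ (*ᴸ-comm (num F) (den G))
  (transˢ (coeff-* (den G) (num F))
  (transˢ (•-cong (den G) (symˢ (IsExpansion.solves (expF w S ex))))
  (transˢ (•-comm (den G) (den F) (keepIntegral y S))
  (transˢ (•-cong (den F) (IsExpansion.solves (expG w S ex)))
  (transˢ (symˢ (coeff-* (den F) (num G)))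
          (*ᴸ-comm (den F) (num G))))))))

-- Determined by Is𝒵: another F with Is𝒵 y E F gives the same rational function (𝒵-unique).
𝒵 : Fin N → Fraction N d → Fraction N d
𝒵 y E = proj₁ (𝒵-exists y E)

sgn : ℚ → ℚ
sgn q = sign (↥ q)
  where
  sign : ℤ → ℚ
  sign +0       = 0ℚ
  sign +[1+ _ ] = 1ℚ
  sign -[1+ _ ] = -ℚ 1ℚ

-- Coprimality as polynomials in x^(1/M), M large, over the field of fractional
-- rational functions in the other variables: f and g generate the unit ideal.
-- The Bézout identity is stated with denominators cleared.
CoprimeIn : Fin N → Laurent N → Laurent N → Set
CoprimeIn x f g = ∃[ a ] ∃[ b ] ∃[ c ]
  a *ᴸ f +ᴸ b *ᴸ g ≐ c × FreeOf x c × ¬ (c ≐ [])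

-- The conditions under which CT_{x,j} E is defined, y being the variable y_j:
-- writing x^(factor E l) = u_l x^(b_l), y occurs in E only in u_j = y · u_j′.
record Admissible (x y : Fin N) (j : Fin d) (E : Fraction N d) : Set where
  field
    x≢y     : x ≢ y
    defined : WellDefined E
    coprime : ∀ {l m} → l ∈ active E → m ∈ active E → l ≢ m →
              CoprimeIn x (binomial (factor E l)) (binomial (factor E m))
    j∈      : j ∈ active E
    b≢0     : NonZero (lookup (factor E j) x)
    y-in-uⱼ : lookup (factor E j) y ≡ 1ℚ
    y∉num   : FreeOf y (num E)
    y∉rest  : ∀ {l} → l ∈ active E → l ≢ j → lookup (factor E l) y ≡ 0ℚ

-- The monomial obtained from x^e by putting x^v for the variable x.
substᵉ : Fin N → Exponent N → Exponent N → Exponent N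
substᵉ x v e = (e [ x ]≔ 0ℚ) ⊕ (lookup e x ⊛ v)

substᶠ : Fin N → Exponent N → Fraction N d → Fraction N d
substᶠ x v E = fraction (List.map (map₂ (substᵉ x v)) (num E)) (active E) (substᵉ x v ∘ factor E)

-- E · (1 - x^(factor E j)), for j ∈ active E.
cancel : Fin d → Fraction N d → Fraction N d
cancel j E = record E { active = active E - j }

CT : ∀ (x y : Fin N) (j : Fin d) (E : Fraction N d) → Admissible x y j E → Fraction N d
CT x y j E adm = scale (sgn b) (𝒵 y (substᶠ x ((-ℚ (1/ b)) ⊛ u) (cancel j E)))
  where
  b = lookup (factor E j) x
  u = factor E j [ x ]≔ 0ℚ
  instance _ = Admissible.b≢0 adm

Matrix : Set → ℕ → ℕ → Set
Matrix A m n = Vector (Vector A n) m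

module _ {n r : ℕ} where

  yᵛ : Fin n → Fin (n ℕ.+ r)
  yᵛ j = j ↑ˡ r

  λᵛ : Fin r → Fin (n ℕ.+ r)
  λᵛ i = n ↑ʳ i

  col : Fin n → Fin (n ℕ.+ 1)
  col j = j ↑ˡ 1

  lastCol : Fin (n ℕ.+ 1)
  lastCol = n ↑ʳ zero

  initial : Matrix ℤ r n → Vector ℤ r → Matrix ℚ (n ℕ.+ r) (n ℕ.+ 1)
  initial A b =
    (λ s → (λ t → if does (s Fin.≟ t) then 1ℚ else 0ℚ) Functional.++ (0ℚ Functional.∷ Functional.[]))
    Functional.++
    (λ i → (λ t → A i t / 1) Functional.++ ((ℤ.- b i) / 1 Functional.∷ Functional.[]))

  pivotItem : Matrix ℚ (n ℕ.+ r) (n ℕ.+ 1) → Fin r → Fin n → ℚ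
  pivotItem O i j = O (λᵛ i) (col j)

  pivot : (O : Matrix ℚ (n ℕ.+ r) (n ℕ.+ 1)) (i : Fin r) (j : Fin n) → .{{NonZero (pivotItem O i j)}} →
          Matrix ℚ (n ℕ.+ r) (n ℕ.+ 1)
  pivot O i j t s = if does (s Fin.≟ col j) then O t s
    else O t s +ℚ (-ℚ (O (λᵛ i) s ÷ pivotItem O i j)) *ℚ O t (col j)

  -- O is a matrix M_k⟨I;J⟩ obtained from M by k pivots.
  data Pivoted (M : Matrix ℚ (n ℕ.+ r) (n ℕ.+ 1)) :
       ℕ → Subset r → Subset n → Matrix ℚ (n ℕ.+ r) (n ℕ.+ 1) → Set where
    start : Pivoted M 0 ⊥ ⊥ M
    step  : ∀ {k I J O} → Pivoted M k I J O → ∀ {i j} → i ∉ I → j ∉ J →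
            .{{_ : NonZero (pivotItem O i j)}} →
            Pivoted M (suc k) (I ∪ ⁅ i ⁆) (J ∪ ⁅ j ⁆) (pivot O i j)

  -- (𝐲,Λ)^γ for the column γ = c, the entries in the rows n + I being omitted.
  column : Subset r → Matrix ℚ (n ℕ.+ r) (n ℕ.+ 1) → Fin (n ℕ.+ 1) → Exponent (n ℕ.+ r)
  column I O c = Vec.tabulate (λ s → O (yᵛ s) c)
    Vec.++ Vec.tabulate (λ i → if lookup I i then 0ℚ else O (λᵛ i) c)

  ⟦_,_,_⟧ : Subset r → Subset n → Matrix ℚ (n ℕ.+ r) (n ℕ.+ 1) → Fraction (n ℕ.+ r) n
  ⟦ I , J , O ⟧ = fraction ((1ℚ , column I O lastCol) ∷ []) (∁ J) (λ l → column I O (col l))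

{-# OPTIONS --safe #-}
-- For t ∉ J, row t of M_k⟨I;J⟩ is still the unit row e_t.  So y_j occurs in the
-- j-th denominator factor only, and any two factors x^f, x^g are independent
-- monomials; taking integers s, t for which s f and t g have the same exponent of
-- λ_i, the ideal of 1 - x^f and 1 - x^g contains the nonzero λ_i-free element
-- 1 - x^(t g - s f).  Substituting λ_i = u_j^(-1/b_j) adds -e_i/b_j times γ_j
-- (with row i dropped) to an exponent e, which is the column operation of the
-- pivot: the two fractions under 𝒵 agree factor by factor.
module Submission where

open import Defs
open import Data.Nat using (ℕ; _+_)
open import Data.Integer using (ℤ)
open import Data.Rational using (ℚ; NonZero)
open import Data.Fin using (Fin)
open import Data.Fin.Subset using (Subset; _∉_; _∪_; ⁅_⁆)
open import Data.Vec.Functional using (Vector)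
open import Data.Product using (Σ-syntax)

open import Data.Bool using (true; false; if_then_else_; _∨_)
open import Data.Bool.Properties using (∨-identityʳ)
open import Data.Fin using (zero; _↑ˡ_; _↑ʳ_; splitAt)
import Data.Fin as Fin
import Data.Fin.Properties as Fin
open import Data.Fin.Subset using (_∈_; ∁; _─_)
open import Data.Fin.Subset.Properties
  using (_∈?_; x∈⁅x⁆; x∈⁅y⁆⇒x≡y; x∈p∪q⁺; x∈∁p⇒x∉p; x∉p⇒x∈∁p)
open import Data.Integer using (+_; -[1+_])
import Data.Integer as ℤ
import Data.Integer.Properties as ℤ
open import Data.List using ([]; _∷_; foldr; allFin)
import Data.List as List
import Data.List.Properties as List
import Data.List.Relation.Unary.All as All
open import Data.List.Relation.Unary.All.Properties using (all-filter)
open import Data.List.Membership.Propositional using () renaming (_∈_ to _∈ˡ_)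
open import Data.List.Relation.Unary.Any using (here; there)
open import Data.Nat using (suc)
import Data.Nat as ℕ
open import Data.Product using (∃-syntax; _×_; _,_; proj₁; proj₂)
open import Data.Rational using (0ℚ; 1ℚ; 1/_; _÷_; ↥_; ↧_)
  renaming (_+_ to _+ℚ_; _*_ to _*ℚ_; _-_ to _-ℚ_; -_ to -ℚ_)
import Data.Rational as ℚ
import Data.Rational.Properties as ℚ
open import Data.Rational.Solver using (module +-*-Solver)
open +-*-Solver using (solve; _:+_; _:*_; :-_; _:=_; con)
open import Data.Rational.Unnormalised using (mkℚᵘ; *≡*)
import Data.Rational.Unnormalised.Properties as ℚᵘ
open import Data.Sum using (inj₁; inj₂; [_,_]′)
open import Data.Vec using ([]; _∷_; lookup; _[_]≔_)
import Data.Vec as Vec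
import Data.Vec.Properties as Vec
open import Function using (_∘_; _$_)
open import Relation.Binary.PropositionalEquality
open import Relation.Nullary using (¬_; yes; no; does; contradiction)
open import Relation.Nullary.Decidable using (dec-true; dec-false)

private variable
  N d n r k : ℕ

-- Integer multiples of rational numbers.

ι-* : ∀ a b → ι (a ℤ.* b) ≡ ι a *ℚ ι b
ι-* a b = ℚ.toℚᵘ-injective $ ℚᵘ.≃-trans (ℚ.toℚᵘ-fromℚᵘ (mkℚᵘ (a ℤ.* b) 0)) $ ℚᵘ.≃-sym $
  ℚᵘ.≃-trans (ℚ.toℚᵘ-homo-* (ι a) (ι b)) $
  ℚᵘ.*-cong (ℚ.toℚᵘ-fromℚᵘ (mkℚᵘ a 0)) (ℚ.toℚᵘ-fromℚᵘ (mkℚᵘ b 0))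

ι≡0⇒≡0 : ∀ z → ι z ≡ 0ℚ → z ≡ + 0
ι≡0⇒≡0 z eq with ℚᵘ.≃-trans (ℚᵘ.≃-sym (ℚ.toℚᵘ-fromℚᵘ (mkℚᵘ z 0))) (ℚᵘ.≃-reflexive (cong ℚ.toℚᵘ eq))
... | *≡* p = trans (sym (ℤ.*-identityʳ z)) p

-- Each denominator clears its own fraction, so both sides are the product of the two numerators.
integer-multiples-meet : ∀ p q → ι (↥ q ℤ.* ↧ p) *ℚ p ≡ ι (↥ p ℤ.* ↧ q) *ℚ q
integer-multiples-meet p q = begin
  ι (↥ q ℤ.* ↧ p) *ℚ p         ≡⟨ cong (_*ℚ p) (ι-* (↥ q) (↧ p)) ⟩
  (ι (↥ q) *ℚ ι (↧ p)) *ℚ p    ≡⟨ ℚ.*-assoc (ι (↥ q)) (ι (↧ p)) p ⟩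
  ι (↥ q) *ℚ (ι (↧ p) *ℚ p)    ≡⟨ cong₂ _*ℚ_ (sym (ι-clear q)) (ι-clear p) ⟩
  (ι (↧ q) *ℚ q) *ℚ ι (↥ p)    ≡⟨ solve 3 (λ a b c → (a :* b) :* c := (c :* a) :* b) refl (ι (↧ q)) q (ι (↥ p)) ⟩
  (ι (↥ p) *ℚ ι (↧ q)) *ℚ q    ≡⟨ cong (_*ℚ q) (sym (ι-* (↥ p) (↧ q))) ⟩
  ι (↥ p ℤ.* ↧ q) *ℚ q         ∎
  where open ≡-Reasoning

-- Divisibility and coprimality of binomials.

neg-⊛ : ∀ a (m : Exponent N) → (-ℚ a) ⊛ m ≡ 𝟘 ⊖ (a ⊛ m)
neg-⊛ a []      = refl
neg-⊛ a (b ∷ m) = cong₂ _∷_ (solve 2 (λ a b → (:- a) :* b := con 0ℚ :+ (:- (a :* b))) refl a b) (neg-⊛ a m)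

⊖-⊖ : (e f g : Exponent N) → (e ⊖ (𝟘 ⊖ f)) ⊖ g ≡ e ⊖ (g ⊖ f)
⊖-⊖ []      []      []      = refl
⊖-⊖ (a ∷ e) (b ∷ f) (c ∷ g) = cong₂ _∷_
  (solve 3 (λ a b c → (a :+ (:- (con 0ℚ :+ (:- b)))) :+ (:- c) := a :+ (:- (c :+ (:- b)))) refl a b c) (⊖-⊖ e f g)

monomial : ℚ → Exponent N → Laurent N
monomial c m = (c , m) ∷ []

monomial-• : ∀ c m (S : Series N) e → (monomial c m • S) e ≡ c *ℚ S (e ⊖ m)
monomial-• c m S e = ℚ.+-identityʳ (c *ℚ S (e ⊖ m))

-- For a nonnegative multiple the quotient is a geometric sum. A negative one reduces to it by 1 -
-- X^(-k) = -X^(-k) (1 - X^k). The quotient is described by its action on series, the form in which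
-- `geometric-•` supplies it.
binomial-∣-power : ∀ z (m : Exponent N) → ∃[ g ] ∀ S → binomial (ι z ⊛ m) • S ≗ˢ g • (binomial m • S)
binomial-∣-power (+ t)    m = geometric t m , geometric-• t m
binomial-∣-power -[1+ t ] m = monomial (-ℚ 1ℚ) h *ᴸ geometric (suc t) m , λ S e → sym (begin
  ((monomial (-ℚ 1ℚ) h *ᴸ geometric (suc t) m) • (binomial m • S)) e
    ≡⟨ •-* (monomial (-ℚ 1ℚ) h) (geometric (suc t) m) (binomial m • S) e ⟩
  (monomial (-ℚ 1ℚ) h • (geometric (suc t) m • (binomial m • S))) e
    ≡⟨ •-cong (monomial (-ℚ 1ℚ) h) (symˢ (geometric-• (suc t) m S)) e ⟩
  (monomial (-ℚ 1ℚ) h • (binomial m′ • S)) e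
    ≡⟨ monomial-• (-ℚ 1ℚ) h (binomial m′ • S) e ⟩
  -ℚ 1ℚ *ℚ (binomial m′ • S) (e ⊖ h)
    ≡⟨ cong (-ℚ 1ℚ *ℚ_) (binomial-• m′ S (e ⊖ h)) ⟩
  -ℚ 1ℚ *ℚ (S (e ⊖ h) -ℚ S ((e ⊖ h) ⊖ m′))
    ≡⟨ cong (λ f → -ℚ 1ℚ *ℚ (S (e ⊖ h) -ℚ S f)) (trans (cong (λ h → (e ⊖ h) ⊖ m′) h≡) (⊖-neg′ e m′)) ⟩
  -ℚ 1ℚ *ℚ (S (e ⊖ h) -ℚ S e)
    ≡⟨ solve 2 (λ a b → :- con 1ℚ :* (a :+ (:- b)) := b :+ (:- a)) refl (S (e ⊖ h)) (S e) ⟩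
  S e -ℚ S (e ⊖ h)
    ≡⟨ sym (binomial-• h S e) ⟩
  (binomial h • S) e ∎)
  where
  open ≡-Reasoning
  h  = ι -[1+ t ] ⊛ m
  m′ = suc t ×ᵉ m
  h≡ : h ≡ 𝟘 ⊖ m′
  h≡ = trans (cong (_⊛ m) (ι-neg (+ suc t))) (neg-⊛ (ι (+ suc t)) m)

-- The coefficient at `m` is -1, since the constant term lies at a different exponent.
binomial≢0 : (m : Exponent N) → m ≢ 𝟘 → ¬ (binomial m ≐ [])
binomial≢0 m m≢𝟘 eq with eq m
... | p rewrite dec-false (m ≟ᵉ 𝟘) m≢𝟘 | dec-true (m ≟ᵉ m) refl with p
... | ()

binomial-freeOf : ∀ x (m : Exponent N) → lookup m x ≡ 0ℚ → FreeOf x (binomial m)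
binomial-freeOf x m mₓ≡0 e ne with coeff-support (binomial m) e ne
... | here refl         = Vec.lookup-replicate x 0ℚ
... | there (here refl) = mₓ≡0

≢𝟘 : ∀ y {m : Exponent N} → lookup m y ≢ 0ℚ → m ≢ 𝟘
≢𝟘 y ne refl = ne (Vec.lookup-replicate y 0ℚ)

integer-multiple≢0 : ∀ p q → p ≢ 0ℚ → ι (↥ p ℤ.* ↧ q) ≢ 0ℚ
integer-multiple≢0 p q p≢0 eq =
  [ p≢0 ∘ ℚ.↥p≡0⇒p≡0 p , (λ ()) ]′ (ℤ.i*j≡0⇒i≡0∨j≡0 (↥ p) {↧ q} (ι≡0⇒≡0 (↥ p ℤ.* ↧ q) eq))

-- Equal exponents of `x` in s f and t g cancel in t g - s f. The exponent of `y` there is t, which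
-- keeps the resulting binomial from vanishing.
common-multiple⇒coprime : ∀ x y (f g : Exponent N) s t →
  ι s *ℚ lookup f x ≡ ι t *ℚ lookup g x → ι t ≢ 0ℚ → lookup f y ≡ 0ℚ → lookup g y ≡ 1ℚ →
  CoprimeIn x (binomial f) (binomial g)
common-multiple⇒coprime x y f g s t sf≡tg t≢0 f-y g-y =
  -- `G` and `H` turn the two binomials into those of s f and t g. The common shift by `h` makes the
  -- terms at `h` cancel in the sum.
  monomial (-ℚ 1ℚ) h *ᴸ G , monomial 1ℚ h *ᴸ H , binomial m , eq
  , binomial-freeOf x m m-x , binomial≢0 m (≢𝟘 y (t≢0 ∘ trans (sym m-y)))
  where
  open ≡-Reasoning
  h = 𝟘 ⊖ (ι s ⊛ f)
  m = (ι t ⊛ g) ⊖ (ι s ⊛ f)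
  G = proj₁ (binomial-∣-power s f)
  H = proj₁ (binomial-∣-power t g)
  lookup-m : ∀ z → lookup m z ≡ ι t *ℚ lookup g z -ℚ ι s *ℚ lookup f z
  lookup-m z = trans (lookup-⊖ (ι t ⊛ g) (ι s ⊛ f) z)
    (cong₂ _-ℚ_ (Vec.lookup-map z (ι t *ℚ_) g) (Vec.lookup-map z (ι s *ℚ_) f))
  m-x : lookup m x ≡ 0ℚ
  m-x = trans (lookup-m x) (trans
    (cong (λ v → ι t *ℚ lookup g x -ℚ v) sf≡tg)
    (ℚ.+-inverseʳ (ι t *ℚ lookup g x)))
  m-y : lookup m y ≡ ι t
  m-y = trans (lookup-m y) (trans (cong₂ (λ a b → ι t *ℚ a -ℚ ι s *ℚ b) g-y f-y)
    (solve 2 (λ t s → t :* con 1ℚ :+ (:- (s :* con 0ℚ)) := t) refl (ι t) (ι s)))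
  multiple : ∀ c z (e : Exponent _) e′ → ((monomial c h *ᴸ proj₁ (binomial-∣-power z e) *ᴸ binomial e) • δ) e′
    ≡ c *ℚ (δ (e′ ⊖ h) -ℚ δ ((e′ ⊖ h) ⊖ (ι z ⊛ e)))
  multiple c z e e′ = begin
    ((monomial c h *ᴸ P *ᴸ binomial e) • δ) e′        ≡⟨ •-* (monomial c h *ᴸ P) (binomial e) δ e′ ⟩
    ((monomial c h *ᴸ P) • (binomial e • δ)) e′       ≡⟨ •-* (monomial c h) P (binomial e • δ) e′ ⟩
    (monomial c h • (P • (binomial e • δ))) e′        ≡⟨ monomial-• c h (P • (binomial e • δ)) e′ ⟩
    c *ℚ (P • (binomial e • δ)) (e′ ⊖ h)              ≡⟨ cong (c *ℚ_) (sym (proj₂ (binomial-∣-power z e) δ (e′ ⊖ h))) ⟩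
    c *ℚ (binomial (ι z ⊛ e) • δ) (e′ ⊖ h)            ≡⟨ cong (c *ℚ_) (binomial-• (ι z ⊛ e) δ (e′ ⊖ h)) ⟩
    c *ℚ (δ (e′ ⊖ h) -ℚ δ ((e′ ⊖ h) ⊖ (ι z ⊛ e)))     ∎
    where P = proj₁ (binomial-∣-power z e)
  -- -x^(-s f) (1 - x^(s f)) + x^(-s f) (1 - x^(t g)) = 1 - x^(t g - s f)
  eq : monomial (-ℚ 1ℚ) h *ᴸ G *ᴸ binomial f +ᴸ monomial 1ℚ h *ᴸ H *ᴸ binomial g ≐ binomial m
  eq e = begin
    coeff (a +ᴸ b) e
      ≡⟨ coeff-• (a +ᴸ b) e ⟩
    ((a +ᴸ b) • δ) e
      ≡⟨ •-++ a b δ e ⟩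
    (a • δ) e +ℚ (b • δ) e
      ≡⟨ cong₂ _+ℚ_ (multiple (-ℚ 1ℚ) s f e) (multiple 1ℚ t g e) ⟩
    -ℚ 1ℚ *ℚ (δ (e ⊖ h) -ℚ δ ((e ⊖ h) ⊖ (ι s ⊛ f))) +ℚ 1ℚ *ℚ (δ (e ⊖ h) -ℚ δ ((e ⊖ h) ⊖ (ι t ⊛ g)))
      ≡⟨ cong₂ (λ u v → -ℚ 1ℚ *ℚ (δ (e ⊖ h) -ℚ δ u) +ℚ 1ℚ *ℚ (δ (e ⊖ h) -ℚ δ v))
           (⊖-neg′ e (ι s ⊛ f)) (⊖-⊖ e (ι s ⊛ f) (ι t ⊛ g)) ⟩
    -ℚ 1ℚ *ℚ (δ (e ⊖ h) -ℚ δ e) +ℚ 1ℚ *ℚ (δ (e ⊖ h) -ℚ δ (e ⊖ m))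
      ≡⟨ solve 3 (λ u v w → :- con 1ℚ :* (u :+ (:- v)) :+ con 1ℚ :* (u :+ (:- w)) := v :+ (:- w)) refl
           (δ (e ⊖ h)) (δ e) (δ (e ⊖ m)) ⟩
    δ e -ℚ δ (e ⊖ m)
      ≡⟨ sym (binomial-• m δ e) ⟩
    (binomial m • δ) e
      ≡⟨ sym (coeff-• (binomial m) e) ⟩
    coeff (binomial m) e ∎
    where
    a = monomial (-ℚ 1ℚ) h *ᴸ G *ᴸ binomial f
    b = monomial 1ℚ h *ᴸ H *ᴸ binomial g

binomials-coprime : ∀ x y (f g : Exponent N) → f ≢ 𝟘 → lookup f y ≡ 0ℚ → lookup g y ≡ 1ℚ →
  CoprimeIn x (binomial f) (binomial g)
binomials-coprime x y f g f≢𝟘 f-y g-y with lookup f x ℚ.≟ 0ℚ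
-- Here `binomial f` is itself a nonzero element of the ideal that is free of `x`.
... | yes fₓ≡0 = 1ᴸ , [] , binomial f , eq , binomial-freeOf x f fₓ≡0 , binomial≢0 f f≢𝟘
  where
  eq : 1ᴸ *ᴸ binomial f +ᴸ [] *ᴸ binomial g ≐ binomial f
  eq rewrite List.++-identityʳ (1ᴸ *ᴸ binomial f) =
    transˢ (coeff-* 1ᴸ (binomial f)) (1• coeff (binomial f))
-- If `q` is 0, then s is 0 and t is still nonzero, so this choice also covers a `g` free of `x`.
... | no fₓ≢0 = common-multiple⇒coprime x y f g (↥ q ℤ.* ↧ p) (↥ p ℤ.* ↧ q)
  (integer-multiples-meet p q) (integer-multiple≢0 p q fₓ≢0) f-y g-y
  where
  p = lookup f x
  q = lookup g x

-- Comparing fractions under `𝒵`.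

-- Agreement is asked on active indices only: at the pivot index the substitution sends the factor's
-- exponent to `𝟘`, whereas the pivot keeps that column.
factors-cong : {E F : Fraction N d} → active E ≡ active F →
  (∀ {l} → l ∈ active F → factor E l ≡ factor F l) → factors E ≡ factors F
factors-cong {F = F} refl eq = List.map-cong-local (All.map eq (all-filter (_∈? active F) (allFin _)))

-- The numerator and denominator of a multisection depend only on the original numerator and the
-- list of active factors. They therefore agree as lists even where the factor functions differ off
-- the active set.
scale-𝒵-cong : ∀ {p q} y {E F : Fraction N d} → p ≡ q → num E ≡ num F → active E ≡ active F →
  (∀ {l} → l ∈ active F → factor E l ≡ factor F l) → WellDefined F → scale p (𝒵 y E) ≈ scale q (𝒵 y F)
scale-𝒵-cong {p = p} y {E} {F} refl num≡ refl factor≡ wd = mk≈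
  (Is𝒵.defined (multisection-is𝒵 y E) λ l∈ → subst (_≢ 𝟘) (sym (factor≡ l∈)) (wd l∈))
  (Is𝒵.defined (multisection-is𝒵 y F) wd)
  λ e → cong (λ f → coeff f e) (cong₂ _*ᴸ_ num𝒵≡ (sym den𝒵≡))
  where
  factors≡ : factors E ≡ factors F
  factors≡ = factors-cong {E = E} {F} refl factor≡
  num𝒵≡ : num (scale p (𝒵 y E)) ≡ num (scale p (𝒵 y F))
  -- `active F` and `factor F` are mere placeholders here, since `num` does not inspect them.
  num𝒵≡ = cong₂ (λ f ms → num (scale p (fraction
    (keepIntegralᴸ y (foldr (λ m f → geometric (order y m) m *ᴸ f) f ms)) (active F) (factor F)))) num≡ factors≡
  den𝒵≡ : den (𝒵 y E) ≡ den (𝒵 y F)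
  den𝒵≡ = cong ∏binomial (trans (map-factor y E) (trans
    (cong (List.map (λ m → order y m ×ᵉ m)) factors≡) (sym (map-factor y F))))

-- Index sets and coordinates.

-- Identifies the factors left by `cancel` with those left by enlarging the set of ignored columns.
∁-─ : (p q : Subset n) → ∁ p ─ q ≡ ∁ (p ∪ q)
∁-─ []          []          = refl
∁-─ (true  ∷ p) (true  ∷ q) = cong (_ ∷_) (∁-─ p q)
∁-─ (true  ∷ p) (false ∷ q) = cong (_ ∷_) (∁-─ p q)
∁-─ (false ∷ p) (true  ∷ q) = cong (_ ∷_) (∁-─ p q)
∁-─ (false ∷ p) (false ∷ q) = cong (_ ∷_) (∁-─ p q)

∉⇒lookup≡false : ∀ {i} {I : Subset r} → i ∉ I → lookup I i ≡ false
∉⇒lookup≡false {i = i} {I} i∉I with lookup I i in eq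
... | true  = contradiction (Vec.lookup⇒[]= i I eq) i∉I
... | false = refl

lookup-∪⁅⁆ : ∀ (I : Subset r) i → lookup (I ∪ ⁅ i ⁆) i ≡ true
lookup-∪⁅⁆ I i = Vec.[]=⇒lookup (x∈p∪q⁺ {p = I} (inj₂ (x∈⁅x⁆ i)))

lookup-∪⁅⁆-≢ : ∀ (I : Subset r) {i t} → t ≢ i → lookup (I ∪ ⁅ i ⁆) t ≡ lookup I t
lookup-∪⁅⁆-≢ I {i} {t} t≢i = trans (Vec.lookup-zipWith _∨_ t I ⁅ i ⁆)
  (trans (cong (lookup I t ∨_) (∉⇒lookup≡false (t≢i ∘ x∈⁅y⁆⇒x≡y i))) (∨-identityʳ (lookup I t)))

∉-∪⁻ : ∀ (J : Subset n) {j t} → t ∉ J ∪ ⁅ j ⁆ → t ∉ J × t ≢ j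
∉-∪⁻ J {j} t∉ = (λ t∈J → t∉ (x∈p∪q⁺ (inj₁ t∈J))) , λ { refl → t∉ (x∈p∪q⁺ {p = J} (inj₂ (x∈⁅x⁆ j))) }

↑ˡ≢↑ʳ : ∀ (s : Fin n) (t : Fin r) → s ↑ˡ r ≢ n ↑ʳ t
↑ˡ≢↑ʳ {n} {r} s t eq with trans (sym (Fin.splitAt-↑ˡ n s r)) (trans (cong (splitAt n) eq) (Fin.splitAt-↑ʳ n r t))
... | ()

++-ext : (e f : Exponent (n + r)) → (∀ s → lookup e (yᵛ s) ≡ lookup f (yᵛ s)) →
  (∀ t → lookup e (λᵛ {n} t) ≡ lookup f (λᵛ {n} t)) → e ≡ f
++-ext {n} {r} e f eqʸ eqᴸ = trans (sym (Vec.tabulate∘lookup e))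
  (trans (Vec.tabulate-cong pointwise) (Vec.tabulate∘lookup f))
  where
  pointwise : ∀ u → lookup e u ≡ lookup f u
  pointwise u with splitAt n u in eq
  ... | inj₁ s = subst (λ u → lookup e u ≡ lookup f u) (Fin.splitAt⁻¹-↑ˡ eq) (eqʸ s)
  ... | inj₂ t = subst (λ u → lookup e u ≡ lookup f u) (Fin.splitAt⁻¹-↑ʳ eq) (eqᴸ t)

-- Substitutions, columns and pivots, entry by entry.

lookup-substᵉ : ∀ (x : Fin N) v e t →
  lookup (substᵉ x v e) t ≡ lookup (e [ x ]≔ 0ℚ) t +ℚ lookup e x *ℚ lookup v t
lookup-substᵉ x v e t = trans (Vec.lookup-zipWith _+ℚ_ t (e [ x ]≔ 0ℚ) (lookup e x ⊛ v))
  (cong (lookup (e [ x ]≔ 0ℚ) t +ℚ_) (Vec.lookup-map t (lookup e x *ℚ_) v))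

lookup-substᵉ-self : ∀ (x : Fin N) a f e → lookup (substᵉ x (a ⊛ (f [ x ]≔ 0ℚ)) e) x ≡ 0ℚ
lookup-substᵉ-self x a f e = trans (lookup-substᵉ x (a ⊛ (f [ x ]≔ 0ℚ)) e x) (trans
  (cong₂ (λ p q → p +ℚ lookup e x *ℚ q) (Vec.lookup∘update x e 0ℚ)
    (trans (Vec.lookup-map x (a *ℚ_) (f [ x ]≔ 0ℚ)) (cong (a *ℚ_) (Vec.lookup∘update x f 0ℚ))))
  (solve 2 (λ a b → con 0ℚ :+ b :* (a :* con 0ℚ) := con 0ℚ) refl a (lookup e x)))

-- Away from `x` neither update is visible, and what remains is a column operation: a multiple of
-- `f` is added to `e`.
lookup-substᵉ-≢ : ∀ (x : Fin N) a f e {t} → t ≢ x →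
  lookup (substᵉ x (a ⊛ (f [ x ]≔ 0ℚ)) e) t ≡ lookup e t +ℚ lookup e x *ℚ (a *ℚ lookup f t)
lookup-substᵉ-≢ x a f e {t} t≢x = trans (lookup-substᵉ x (a ⊛ (f [ x ]≔ 0ℚ)) e t)
  (cong₂ (λ p q → p +ℚ lookup e x *ℚ q) (Vec.lookup∘update′ t≢x e 0ℚ)
    (trans (Vec.lookup-map t (a *ℚ_) (f [ x ]≔ 0ℚ)) (cong (a *ℚ_) (Vec.lookup∘update′ t≢x f 0ℚ))))

lookup-column-y : ∀ (I : Subset r) (O : Matrix ℚ (n + r) (n + 1)) c (s : Fin n) →
  lookup (column I O c) (yᵛ s) ≡ O (yᵛ s) c
lookup-column-y {r} I O c s = trans (Vec.lookup-++ˡ (Vec.tabulate (λ s → O (yᵛ s) c)) _ s)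
  (Vec.lookup∘tabulate (λ s → O (yᵛ s) c) s)

lookup-column-λ : ∀ (I : Subset r) (O : Matrix ℚ (n + r) (n + 1)) c t →
  lookup (column I O c) (λᵛ t) ≡ (if lookup I t then 0ℚ else O (λᵛ t) c)
lookup-column-λ {r} {n} I O c t = trans (Vec.lookup-++ʳ (Vec.tabulate (λ (s : Fin n) → O (yᵛ s) c)) (Vec.tabulate g) t)
  (Vec.lookup∘tabulate g t)
  where
  g : Fin r → ℚ
  g t = if lookup I t then 0ℚ else O (λᵛ t) c

lookup-column-λ-∉ : ∀ {I : Subset r} (O : Matrix ℚ (n + r) (n + 1)) c {t} → t ∉ I →
  lookup (column I O c) (λᵛ t) ≡ O (λᵛ t) c
lookup-column-λ-∉ {r} {n} {I} O c {t} t∉I = trans (lookup-column-λ I O c t)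
  (cong (λ z → if z then 0ℚ else O (λᵛ t) c) (∉⇒lookup≡false t∉I))

pivot-≢ : ∀ (O : Matrix ℚ (n + r) (n + 1)) (i : Fin r) (j : Fin n)
  .{{_ : NonZero (pivotItem O i j)}} t {c} → c ≢ j ↑ˡ 1 →
  pivot O i j t c ≡ O t c +ℚ (-ℚ (O (λᵛ i) c ÷ pivotItem O i j)) *ℚ O t (j ↑ˡ 1)
pivot-≢ O i j t {c} c≢j rewrite dec-false (c Fin.≟ (j ↑ˡ 1)) c≢j = refl

nonZero⇒≢0 : ∀ p → .{{NonZero p}} → p ≢ 0ℚ
nonZero⇒≢0 _ {{nz}} refl = ℕ.≢-nonZero⁻¹ 0 {{nz}} refl

-- The instances are irrelevant, so `refl` works whichever proofs of nonzeroness the two reciprocals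
-- carry.
1/-cong : ∀ {p q} .{{_ : NonZero p}} .{{_ : NonZero q}} → p ≡ q → 1/ p ≡ 1/ q
1/-cong refl = refl

-- Unit rows of pivoted matrices and admissibility.

module _ (A : Matrix ℤ r n) (b : Vector ℤ r) where

  initial-identity : ∀ (s l : Fin n) → initial A b (yᵛ s) (l ↑ˡ 1) ≡ (if does (s Fin.≟ l) then 1ℚ else 0ℚ)
  initial-identity s l rewrite Fin.splitAt-↑ˡ n s r | Fin.splitAt-↑ˡ n l 1 = refl

  initial-last : ∀ (s : Fin n) → initial A b (yᵛ s) (n ↑ʳ zero) ≡ 0ℚ
  initial-last s rewrite Fin.splitAt-↑ˡ n s r | Fin.splitAt-↑ʳ n 1 zero = refl

  initial-diagonal : ∀ (s : Fin n) → initial A b (yᵛ s) (s ↑ˡ 1) ≡ 1ℚ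
  initial-diagonal s = trans (initial-identity s s)
    (cong (λ z → if z then 1ℚ else 0ℚ) (dec-true (s Fin.≟ s) refl))

  initial-off-diagonal : ∀ {s l : Fin n} → s ≢ l → initial A b (yᵛ s) (l ↑ˡ 1) ≡ 0ℚ
  initial-off-diagonal {s} {l} s≢l = trans (initial-identity s l)
    (cong (λ z → if z then 1ℚ else 0ℚ) (dec-false (s Fin.≟ l) s≢l))

  -- A pivot in column j changes row t by multiples of its entry in column j. As t differs from j,
  -- that entry is by induction still an off-diagonal 0 of the identity block.
  pivoted-row-y : ∀ {I J O} → Pivoted (initial A b) k I J O → ∀ {t : Fin n} → t ∉ J → ∀ c →
    O (yᵛ t) c ≡ initial A b (yᵛ t) c
  pivoted-row-y start t∉J c = refl
  pivoted-row-y (step {J = J} {O} P {i} {j} i∉I j∉J) {t} t∉ c with ∉-∪⁻ J t∉ | c Fin.≟ (j ↑ˡ 1)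
  ... | t∉J , _   | yes _ = pivoted-row-y P t∉J c
  ... | t∉J , t≢j | no  _ = trans
    (cong₂ (λ u v → u +ℚ q *ℚ v) (pivoted-row-y P t∉J c)
      (trans (pivoted-row-y P t∉J (j ↑ˡ 1)) (initial-off-diagonal t≢j)))
    (solve 2 (λ u q → u :+ q :* con 0ℚ := u) refl (initial A b (yᵛ t) c) q)
    where q = -ℚ (O (λᵛ i) c ÷ pivotItem O i j)

  module _ {I J} {O : Matrix ℚ (n + r) (n + 1)} (P : Pivoted (initial A b) k I J O) where

    factor-diagonal : ∀ {l} → l ∉ J → lookup (column I O (l ↑ˡ 1)) (yᵛ l) ≡ 1ℚ
    factor-diagonal {l} l∉J = trans (lookup-column-y I O (l ↑ˡ 1) l)
      (trans (pivoted-row-y P l∉J (l ↑ˡ 1)) (initial-diagonal l))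

    factor-off-diagonal : ∀ {s l} → s ∉ J → s ≢ l → lookup (column I O (l ↑ˡ 1)) (yᵛ s) ≡ 0ℚ
    factor-off-diagonal {s} {l} s∉J s≢l = trans (lookup-column-y I O (l ↑ˡ 1) s)
      (trans (pivoted-row-y P s∉J (l ↑ˡ 1)) (initial-off-diagonal s≢l))

    factor≢𝟘 : ∀ {l} → l ∉ J → column I O (l ↑ˡ 1) ≢ 𝟘
    factor≢𝟘 {l} l∉J = ≢𝟘 (yᵛ l) (λ eq → contradiction (trans (sym (factor-diagonal l∉J)) eq) λ ())

    pivoted-wellDefined : WellDefined ⟦ I , J , O ⟧
    pivoted-wellDefined l∈ = factor≢𝟘 (x∈∁p⇒x∉p l∈)

    pivoted-admissible : ∀ {i j} → i ∉ I → j ∉ J → .{{NonZero (pivotItem O i j)}} →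
      Admissible (λᵛ i) (yᵛ j) j ⟦ I , J , O ⟧
    pivoted-admissible {i} {j} i∉I j∉J = record
      { x≢y     = λ eq → ↑ˡ≢↑ʳ j i (sym eq)
      ; defined = pivoted-wellDefined
      -- The variable y_m separates the two monomials: its exponent is 1 in factor m and 0 in factor
      -- l.
      ; coprime = λ {l} {m} l∈ m∈ l≢m → binomials-coprime (λᵛ i) (yᵛ m)
          (column I O (l ↑ˡ 1)) (column I O (m ↑ˡ 1)) (factor≢𝟘 (x∈∁p⇒x∉p l∈))
          (factor-off-diagonal (x∈∁p⇒x∉p m∈) (l≢m ∘ sym)) (factor-diagonal (x∈∁p⇒x∉p m∈))
      ; j∈      = x∉p⇒x∈∁p j∉J
      ; b≢0     = ℚ.≢-nonZero λ eq →
          nonZero⇒≢0 (pivotItem O i j) (trans (sym (lookup-column-λ-∉ O (j ↑ˡ 1) i∉I)) eq)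
      ; y-in-uⱼ = factor-diagonal j∉J
      ; y∉num   = λ e ne → y∉num (coeff-support (monomial 1ℚ (column I O (n ↑ʳ zero))) e ne)
      ; y∉rest  = λ l∈ l≢j → factor-off-diagonal j∉J (l≢j ∘ sym)
      }
      where
      y∉num : ∀ {e} → e ∈ˡ column I O (n ↑ʳ zero) ∷ [] → lookup e (yᵛ j) ≡ 0ℚ
      -- Row j is unchanged by the pivots, and the last column starts with zeros in the y rows.
      y∉num (here refl) = trans (lookup-column-y I O (n ↑ʳ zero) j)
        (trans (pivoted-row-y P j∉J (n ↑ʳ zero)) (initial-last j))

-- Substitution as a pivot operation.

-- Replacing λ_i by u_j^(-1/b_j) turns its exponent in column c into that multiple of column j,
-- which is the correction made by the pivot. Column j is excluded because the pivot leaves it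
-- alone.
substᵉ-column : ∀ {I : Subset r} (O : Matrix ℚ (n + r) (n + 1)) {i} (j : Fin n) → i ∉ I →
  .{{_ : NonZero (pivotItem O i j)}} →
  let f = column I O (j ↑ˡ 1) in .{{_ : NonZero (lookup f (λᵛ i))}} → ∀ {c} → c ≢ j ↑ˡ 1 →
  substᵉ (λᵛ i) ((-ℚ (1/ lookup f (λᵛ i))) ⊛ (f [ λᵛ i ]≔ 0ℚ)) (column I O c)
    ≡ column (I ∪ ⁅ i ⁆) (pivot O i j) c
substᵉ-column {r} {n} {I} O {i} j i∉I {c} c≢j = ++-ext _ _ row-y row-λ
  where
  open ≡-Reasoning
  f = column I O (j ↑ˡ 1)
  e = column I O c
  p = pivotItem O i j
  a = -ℚ (1/ lookup f (λᵛ i))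
  -- Row i is not yet omitted, so the exponents of λ_i in `e` and `f` are the matrix entries in the
  -- pivot coefficient.
  eliminate : ∀ u v → u +ℚ lookup e (λᵛ i) *ℚ (a *ℚ v) ≡ u +ℚ (-ℚ (O (λᵛ i) c ÷ p)) *ℚ v
  eliminate u v = trans
    (cong₂ (λ x y → u +ℚ x *ℚ ((-ℚ y) *ℚ v)) (lookup-column-λ-∉ O c i∉I) (1/-cong (lookup-column-λ-∉ O (j ↑ˡ 1) i∉I)))
    (solve 4 (λ u x y v → u :+ x :* ((:- y) :* v) := u :+ (:- (x :* y)) :* v) refl u (O (λᵛ i) c) (1/ p) v)
  row-y : ∀ (s : Fin n) → lookup (substᵉ (λᵛ i) (a ⊛ (f [ λᵛ i ]≔ 0ℚ)) e) (yᵛ s)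
                  ≡ lookup (column (I ∪ ⁅ i ⁆) (pivot O i j) c) (yᵛ s)
  row-y s = begin
    lookup (substᵉ (λᵛ i) (a ⊛ (f [ λᵛ i ]≔ 0ℚ)) e) (yᵛ s)
      ≡⟨ lookup-substᵉ-≢ (λᵛ i) a f e (↑ˡ≢↑ʳ s i) ⟩
    lookup e (yᵛ s) +ℚ lookup e (λᵛ i) *ℚ (a *ℚ lookup f (yᵛ s))
      ≡⟨ eliminate (lookup e (yᵛ s)) (lookup f (yᵛ s)) ⟩
    lookup e (yᵛ s) +ℚ (-ℚ (O (λᵛ i) c ÷ p)) *ℚ lookup f (yᵛ s)
      ≡⟨ cong₂ (λ u v → u +ℚ (-ℚ (O (λᵛ i) c ÷ p)) *ℚ v) (lookup-column-y I O c s) (lookup-column-y I O (j ↑ˡ 1) s) ⟩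
    O (yᵛ s) c +ℚ (-ℚ (O (λᵛ i) c ÷ p)) *ℚ O (yᵛ s) (j ↑ˡ 1)
      ≡⟨ sym (pivot-≢ O i j (yᵛ s) c≢j) ⟩
    pivot O i j (yᵛ s) c
      ≡⟨ sym (lookup-column-y (I ∪ ⁅ i ⁆) (pivot O i j) c s) ⟩
    lookup (column (I ∪ ⁅ i ⁆) (pivot O i j) c) (yᵛ s) ∎
  row-λ : ∀ t → lookup (substᵉ (λᵛ i) (a ⊛ (f [ λᵛ i ]≔ 0ℚ)) e) (λᵛ t)
                  ≡ lookup (column (I ∪ ⁅ i ⁆) (pivot O i j) c) (λᵛ t)
  row-λ t with t Fin.≟ i
  -- Both sides are 0: on the left λ_i has been eliminated, on the right row i is now omitted.
  ... | yes refl = trans (lookup-substᵉ-self (λᵛ i) a f e) (sym (trans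
    (lookup-column-λ (I ∪ ⁅ i ⁆) (pivot O i j) c i)
    (cong (λ z → if z then 0ℚ else pivot O i j (λᵛ i) c) (lookup-∪⁅⁆ I i))))
  ... | no t≢i = begin
    lookup (substᵉ (λᵛ i) (a ⊛ (f [ λᵛ i ]≔ 0ℚ)) e) (λᵛ t)
      ≡⟨ lookup-substᵉ-≢ (λᵛ i) a f e (t≢i ∘ Fin.↑ʳ-injective n t i) ⟩
    lookup e (λᵛ t) +ℚ lookup e (λᵛ i) *ℚ (a *ℚ lookup f (λᵛ t))
      ≡⟨ eliminate (lookup e (λᵛ t)) (lookup f (λᵛ t)) ⟩
    lookup e (λᵛ t) +ℚ q *ℚ lookup f (λᵛ t)
      ≡⟨ cong₂ (λ u v → u +ℚ q *ℚ v) (lookup-column-λ I O c t) (lookup-column-λ I O (j ↑ˡ 1) t) ⟩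
    (if lookup I t then 0ℚ else O (λᵛ t) c) +ℚ q *ℚ (if lookup I t then 0ℚ else O (λᵛ t) (j ↑ˡ 1))
      ≡⟨ merge (lookup I t) ⟩
    (if lookup I t then 0ℚ else O (λᵛ t) c +ℚ q *ℚ O (λᵛ t) (j ↑ˡ 1))
      ≡⟨ cong₂ (λ z u → if z then 0ℚ else u) (sym (lookup-∪⁅⁆-≢ I t≢i)) (sym (pivot-≢ O i j (λᵛ t) c≢j)) ⟩
    (if lookup (I ∪ ⁅ i ⁆) t then 0ℚ else pivot O i j (λᵛ t) c)
      ≡⟨ sym (lookup-column-λ (I ∪ ⁅ i ⁆) (pivot {n} O i j) c t) ⟩
    lookup (column {n} (I ∪ ⁅ i ⁆) (pivot {n} O i j) c) (λᵛ {n} t) ∎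
    where
    q = -ℚ (O (λᵛ {n} i) c ÷ p)
    -- Rows omitted earlier stay 0, because the operation only combines zeros there.
    merge : ∀ z {u v} → (if z then 0ℚ else u) +ℚ q *ℚ (if z then 0ℚ else v) ≡ (if z then 0ℚ else u +ℚ q *ℚ v)
    merge true  = solve 1 (λ q → con 0ℚ :+ q :* con 0ℚ := con 0ℚ) refl q
    merge false = refl

theorem12 : ∀ {n r k : ℕ} (A : Matrix ℤ r n) (b : Vector ℤ r)
    {I : Subset r} {J : Subset n} {O : Matrix ℚ (n + r) (n + 1)} →
    Pivoted (initial A b) k I J O →
    (i : Fin r) (j : Fin n) → i ∉ I → j ∉ J →
    .{{_ : NonZero (pivotItem O i j)}} →
    Σ[ adm ∈ Admissible (λᵛ i) (yᵛ j) j ⟦ I , J , O ⟧ ]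
    CT (λᵛ i) (yᵛ j) j ⟦ I , J , O ⟧ adm
    ≈ scale (sgn (pivotItem O i j)) (𝒵 (yᵛ j) ⟦ I ∪ ⁅ i ⁆ , J ∪ ⁅ j ⁆ , pivot O i j ⟧)
theorem12 {n} {r} A b {I} {J} {O} P i j i∉I j∉J = adm , scale-𝒵-cong (yᵛ j)
  -- This is the fraction to which `CT` applies `𝒵`.
  {substᶠ (λᵛ i) ((-ℚ (1/ lookup f (λᵛ {n} i))) ⊛ (f [ λᵛ {n} i ]≔ 0ℚ)) (cancel j ⟦ I , J , O ⟧)}
  {⟦ I ∪ ⁅ i ⁆ , J ∪ ⁅ j ⁆ , pivot O i j ⟧}
  (cong sgn (lookup-column-λ-∉ {n = n} O (j ↑ˡ 1) i∉I))
  -- The last column is never a pivot column, so the numerator undergoes the same operation.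
  (cong (monomial 1ℚ) (substᵉ-column O j i∉I (λ eq → ↑ˡ≢↑ʳ j zero (sym eq))))
  (∁-─ J ⁅ j ⁆)
  (λ {l} l∈ → substᵉ-column O j i∉I
    (proj₂ (∉-∪⁻ J (x∈∁p⇒x∉p l∈)) ∘ Fin.↑ˡ-injective 1 l j))
  -- The new matrix is again a pivoted one, so its active factors contain their own variables.
  (pivoted-wellDefined A b (step P i∉I j∉J))
  where
  adm = pivoted-admissible A b P i∉I j∉J
  f = column {n} I O (j ↑ˡ 1)
  instance _ = Admissible.b≢0 adm
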